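{- The following (incomparable) graph classes of bounded layered tree-independence number admit clique-based separators of sublinear weight: \begin{itemize} \item[(a)] every class of bounded layered tree-independence number with a subquadratic $\theta$-binding function; \item[(b)] every class of bounded layered treewidth; \item[(c)] every class of bounded tree-independence number. \end{itemize}
   Context: All graphs are finite and simple; $\alpha$ is the independence number and $\theta$ the clique cover number (minimum number of cliques covering all vertices). "Incomparable" refers to the three properties (a), (b), (c) of graph classes: of any two of them, neither implies the other. A separation of $G$ is a pair $(A,B)$ of subsets of $V(G)$ with $A\cup B=V(G)$ and no edge between $A\setminus B$ and $B\setminus A$; it is $\beta$-balanced if $\max\{|A\setminus B|,|B\setminus A|\}\le\beta|V(G)|$. A clique-based separator of $G$ is a collection $\mathcal{S}$ of pairwise vertex-disjoint cliques whose union is a balanced separator, i.e. equals $A\cap B$ for a $\beta$-balanced separation $(A,B)$, for a fixed constant $\beta<1$; its weight is $\sum_{C\in\mathcal{S}}\log(|C|+1)$. A class $\mathcal{G}$ admits clique-based separators of sublinear weight if there are a constant $\beta<1$ and a function $w(n)=o(n)$ such that every $n$-vertex graph in $\mathcal{G}$ has a clique-based separator (with balance constant $\beta$) of weight at most $w(n)$. A $\theta$-binding function for $\mathcal{G}$ is a function $f$ such that $\theta(H)\le f(\alpha(H))$ for every $G\in\mathcal{G}$ and every induced subgraph $H$ of $G$; it is subquadratic if $f(x)=o(x^2)$. A tree decomposition of $G$ is a pair $(T,\{X_t\}_{t\in V(T)})$ with $T$ a tree and bags $X_t\subseteq V(G)$ such that every vertex is in some bag, both endpoints of every edge lie in a common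 bag, and for each $u\in V(G)$ the nodes $t$ with $u\in X_t$ induce a connected subgraph of $T$. The tree-independence number of $G$ is the minimum over tree decompositions of $\max_t\alpha(G[X_t])$. A layering of $G$ is an ordered partition $(V_0,V_1,\ldots)$ of $V(G)$ (parts may be empty, all but finitely many are) such that for each edge $uv$ with $u\in V_i$, $v\in V_j$ we have $|i-j|\le1$. The layered treewidth (resp. layered tree-independence number) of $G$ is the minimum $\ell$ such that there are a tree decomposition and a layering of $G$ with $|X_t\cap V_i|\le\ell$ (resp. $\alpha(G[X_t\cap V_i])\le\ell$) for every bag $X_t$ and layer $V_i$. A class has one of these parameters bounded if some constant bounds the parameter for all its graphs.
   Formalization: "Incomparable" is stated except for "(b) does not imply (a)", which is false: layered treewidth at most ℓ makes every induced subgraph H 2ℓ-colourable, so θ(H) ≤ 2ℓ·α(H), and (b) implies (a). -}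

module Defs where

open import Data.Bool.Base using (Bool; T)
open import Data.Bool.Properties using (T?) renaming (_≟_ to _≟ᵇ_)
open import Data.Fin.Base using (Fin; zero; suc; inject₁; fromℕ)
open import Data.Fin.Properties using (all?) renaming (_≟_ to _≟ᶠ_)
open import Data.Fin.Subset
  using (Subset; _∈_; _⊆_; _∩_; _∪_; _─_; ⋃; ⊤; ⁅_⁆; ∣_∣; Empty)
  renaming (⊥ to ∅)
open import Data.Fin.Subset.Properties
  using (_∈?_; _⊆?_; anySubset?; ∣p∣≤n; ∣⊥∣≡0; ∉⊥; ⊥⊆; ⊆-antisym; x∈⁅x⁆; x∈⁅y⁆⇒x≡y;
         x∈p∩q⁺; x∈p∩q⁻; x∈p∪q⁺; x∈p∪q⁻)
open import Data.Integer.Base as ℤ using (+_)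
import Data.Integer.Properties as ℤₚ
open import Data.List.Base using (List; foldr)
import Data.List.Relation.Unary.All as List
open import Data.List.Relation.Unary.AllPairs using (AllPairs)
open import Data.Nat.Base as ℕ
  using (ℕ; zero; suc; NonZero; z≤n; s≤s; _≤_; _<_; _⊔_; ∣_-_∣; ⌊_/2⌋)
import Data.Nat.Properties as ℕₚ
open import Data.Nat.Logarithm using (⌊log₂_⌋)
open import Data.Nat.Logarithm.Core using (⌊log2⌋)
open import Data.Nat.Induction using (<-wellFounded)
open import Data.Product.Base using (Σ; ∃; ∃-syntax; _×_; _,_; proj₁; proj₂)
open import Data.Rational.Unnormalised.Base as ℚ using (ℚᵘ; mkℚᵘ; 0ℚᵘ)
import Data.Rational.Unnormalised.Properties as ℚₚ
open import Data.Sum.Base using (inj₁; inj₂)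
open import Data.Vec.Base using (Vec; []; _∷_; tabulate; toList)
open import Data.Vec.Properties using (≡-dec)
open import Data.Vec.Relation.Unary.All using (All) renaming (all? to allᵛ?)
open import Data.Vec.Relation.Unary.All.Properties using (tabulate⁺)
open import Function.Base using (_∘_)
open import Function.Definitions using (Injective)
open import Induction.WellFounded using (Acc; acc)
open import Relation.Binary.Construct.Closure.ReflexiveTransitive using (Star)
open import Relation.Binary.PropositionalEquality
  using (_≡_; _≢_; refl; sym; trans; cong; subst; subst₂)
open import Relation.Nullary using (¬_; Dec; yes; no; contradiction)
open import Relation.Nullary.Decidable using (⌊_⌋; ¬?; _×-dec_; _→-dec_; map′)
open import Relation.Unary using (Pred; Decidable; U)
open import Level using (0ℓ)

------------------------------------------------------------------------
-- Real numbers, as Bishop's regular sequences of rationals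

1/suc : ℕ → ℚᵘ
1/suc k = mkℚᵘ (+ 1) k

-- Exchanging j and k gives the usual ∣ xⱼ - xₖ ∣ ≤ 1/(j+1) + 1/(k+1).
record ℝ : Set where
  field
    seq     : ℕ → ℚᵘ
    regular : ∀ j k → seq j ℚ.≤ seq k ℚ.+ (1/suc j ℚ.+ 1/suc k)

open ℝ public

infix  4 _≤ᵣ_ _<ᵣ_
infixl 6 _+ᵣ_
infixl 7 _·_

_≤ᵣ_ : ℝ → ℝ → Set
x ≤ᵣ y = ∀ k → seq x k ℚ.≤ seq y k ℚ.+ (1/suc k ℚ.+ 1/suc k)

_<ᵣ_ : ℝ → ℝ → Set
x <ᵣ y = ∃[ k ] seq x k ℚ.+ (1/suc k ℚ.+ 1/suc k) ℚ.< seq y k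

fromℚ : ℚᵘ → ℝ
fromℚ q .seq     _   = q
fromℚ q .regular j k = ℚₚ.≤-trans
  (ℚₚ.≤-reflexive (ℚₚ.≃-sym (ℚₚ.+-identityʳ q)))
  (ℚₚ.+-monoʳ-≤ q (ℚₚ.nonNegative⁻¹ (1/suc j ℚ.+ 1/suc k)))

fromNat : ℕ → ℚᵘ
fromNat n = mkℚᵘ (+ n) 0

fromNatᵣ : ℕ → ℝ
fromNatᵣ n = fromℚ (fromNat n)

private
  twice : ℕ → ℕ
  twice k = suc (k ℕ.+ k)

  halves : ∀ k → 1/suc (twice k) ℚ.+ 1/suc (twice k) ℚ.≃ 1/suc k
  halves k = ℚ.*≡* (cong +_ (lemma k))
    where
    open import Data.Nat.Tactic.RingSolver using (solve-∀)
    lemma : ∀ k → (1 ℕ.* suc (suc (k ℕ.+ k)) ℕ.+ 1 ℕ.* suc (suc (k ℕ.+ k))) ℕ.* suc k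
                ≡ 1 ℕ.* (suc (suc (k ℕ.+ k)) ℕ.* suc (suc (k ℕ.+ k)))
    lemma = solve-∀

  interchange : ∀ a b c d → (a ℚ.+ b) ℚ.+ (c ℚ.+ d) ℚ.≃ (a ℚ.+ c) ℚ.+ (b ℚ.+ d)
  interchange a b c d = solve 4
    (λ a b c d → (a :+ b) :+ (c :+ d) := (a :+ c) :+ (b :+ d)) ℚₚ.≃-refl a b c d
    where
    open import Data.Rational.Unnormalised.Solver
    open +-*-Solver

_+ᵣ_ : ℝ → ℝ → ℝ
(x +ᵣ y) .seq     k   = seq x (twice k) ℚ.+ seq y (twice k)
(x +ᵣ y) .regular j k = begin
  x₁ ℚ.+ y₁                              ≤⟨ ℚₚ.+-mono-≤ (regular x (twice j) (twice k))
                                                        (regular y (twice j) (twice k)) ⟩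
  (x₂ ℚ.+ (a ℚ.+ b)) ℚ.+ (y₂ ℚ.+ (a ℚ.+ b)) ≃⟨ interchange x₂ (a ℚ.+ b) y₂ (a ℚ.+ b) ⟩
  (x₂ ℚ.+ y₂) ℚ.+ ((a ℚ.+ b) ℚ.+ (a ℚ.+ b)) ≃⟨ ℚₚ.+-congʳ (x₂ ℚ.+ y₂) (interchange a b a b) ⟩
  (x₂ ℚ.+ y₂) ℚ.+ ((a ℚ.+ a) ℚ.+ (b ℚ.+ b)) ≃⟨ ℚₚ.+-congʳ (x₂ ℚ.+ y₂)
                                                  (ℚₚ.+-cong (halves j) (halves k)) ⟩
  (x₂ ℚ.+ y₂) ℚ.+ (1/suc j ℚ.+ 1/suc k)     ∎
  where
  open ℚₚ.≤-Reasoning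
  x₁ = seq x (twice j)
  x₂ = seq x (twice k)
  y₁ = seq y (twice j)
  y₂ = seq y (twice k)
  a  = 1/suc (twice j)
  b  = 1/suc (twice k)

_·_ : ℕ → ℝ → ℝ
zero  · x = fromNatᵣ 0
suc n · x = x +ᵣ n · x

private
  log-bounds : ∀ n (ac : Acc _<_ (suc n)) →
    2 ℕ.^ ⌊log2⌋ (suc n) ac ≤ suc n × suc n < 2 ℕ.^ suc (⌊log2⌋ (suc n) ac)
  log-bounds zero    ac       = s≤s z≤n , s≤s (s≤s z≤n)
  log-bounds (suc n) (acc rs) with log-bounds ⌊ n /2⌋ (rs (ℕₚ.⌊n/2⌋<n (suc n)))
  ... | lo , hi = ℕₚ.≤-trans (ℕₚ.*-monoʳ-≤ 2 lo) double≤
                , ℕₚ.<-≤-trans <double (ℕₚ.*-monoʳ-≤ 2 hi)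
    where
    h = ⌊ n /2⌋
    two : ∀ m → 2 ℕ.* suc m ≡ suc (suc (m ℕ.+ m))
    two m = cong suc (trans (cong (m ℕ.+_) (ℕₚ.+-identityʳ (suc m))) (ℕₚ.+-suc m m))
    double≤ : 2 ℕ.* suc h ≤ suc (suc n)
    double≤ rewrite two h = s≤s (s≤s (subst (h ℕ.+ h ≤_) (ℕₚ.⌊n/2⌋+⌈n/2⌉≡n n)
                (ℕₚ.+-monoʳ-≤ h (ℕₚ.⌊n/2⌋≤⌈n/2⌉ n))))
    <double : suc (suc n) < 2 ℕ.* suc (suc h)
    <double rewrite two (suc h) | ℕₚ.+-suc h h = s≤s (s≤s (s≤s (subst (_≤ suc (h ℕ.+ h))
                (ℕₚ.⌊n/2⌋+⌈n/2⌉≡n n)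
                (subst (h ℕ.+ ℕ.⌈ n /2⌉ ≤_) (ℕₚ.+-suc h h)
                  (ℕₚ.+-monoʳ-≤ h (ℕₚ.⌊n/2⌋-mono {suc n} {suc (suc n)} (ℕₚ.n≤1+n (suc n))))))))

  ⌊log⌋-lower : ∀ n .{{_ : NonZero n}} → 2 ℕ.^ ⌊log₂ n ⌋ ≤ n
  ⌊log⌋-lower (suc n) = proj₁ (log-bounds n (<-wellFounded _))

  ⌊log⌋-upper : ∀ n .{{_ : NonZero n}} → n < 2 ℕ.^ suc ⌊log₂ n ⌋
  ⌊log⌋-upper (suc n) = proj₂ (log-bounds n (<-wellFounded _))

  log-cross : ∀ m .{{_ : NonZero m}} p q →
    ⌊log₂ m ℕ.^ p ⌋ ℕ.* q ≤ suc ⌊log₂ m ℕ.^ q ⌋ ℕ.* p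
  log-cross m p q = ℕₚ.≮⇒≥ λ lt → ℕₚ.<⇒≱ (ℕₚ.^-monoʳ-< 2 (s≤s (s≤s z≤n)) lt) (begin
    2 ℕ.^ (a ℕ.* q)       ≡⟨ ℕₚ.^-*-assoc 2 a q ⟨
    (2 ℕ.^ a) ℕ.^ q       ≤⟨ ℕₚ.^-monoˡ-≤ q (⌊log⌋-lower (m ℕ.^ p) {{ℕₚ.m^n≢0 m p}}) ⟩
    (m ℕ.^ p) ℕ.^ q       ≡⟨ ℕₚ.^-*-assoc m p q ⟩
    m ℕ.^ (p ℕ.* q)       ≡⟨ cong (m ℕ.^_) (ℕₚ.*-comm p q) ⟩
    m ℕ.^ (q ℕ.* p)       ≡⟨ ℕₚ.^-*-assoc m q p ⟨
    (m ℕ.^ q) ℕ.^ p       ≤⟨ ℕₚ.^-monoˡ-≤ p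
                               (ℕₚ.<⇒≤ (⌊log⌋-upper (m ℕ.^ q) {{ℕₚ.m^n≢0 m q}})) ⟩
    (2 ℕ.^ suc b) ℕ.^ p   ≡⟨ ℕₚ.^-*-assoc 2 (suc b) p ⟩
    2 ℕ.^ (suc b ℕ.* p)   ∎)
    where
    open ℕₚ.≤-Reasoning
    a = ⌊log₂ m ℕ.^ p ⌋
    b = ⌊log₂ m ℕ.^ q ⌋

-- ⌊log₂ (mᵏ)⌋ / k is within 1/k of the logarithm of m to base 2.
log₂ : (m : ℕ) → .{{NonZero m}} → ℝ
log₂ m .seq     k   = mkℚᵘ (+ ⌊log₂ m ℕ.^ suc k ⌋) k
log₂ m .regular j k = begin
  mkℚᵘ (+ a) j                          ≤⟨ ℚ.*≤* (subst₂ ℤ._≤_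
                                             (ℤₚ.pos-* a (suc k)) (ℤₚ.pos-* (suc b) (suc j))
                                             (ℤ.+≤+ (log-cross m (suc j) (suc k)))) ⟩
  mkℚᵘ (+ suc b) k                      ≃⟨ split ⟩
  mkℚᵘ (+ b) k ℚ.+ 1/suc k              ≃⟨ ℚₚ.+-congʳ (mkℚᵘ (+ b) k)
                                             (ℚₚ.≃-sym (ℚₚ.+-identityˡ (1/suc k))) ⟩
  mkℚᵘ (+ b) k ℚ.+ (0ℚᵘ ℚ.+ 1/suc k)    ≤⟨ ℚₚ.+-monoʳ-≤ (mkℚᵘ (+ b) k)
                                             (ℚₚ.+-monoˡ-≤ (1/suc k)
                                               (ℚₚ.nonNegative⁻¹ (1/suc j))) ⟩
  mkℚᵘ (+ b) k ℚ.+ (1/suc j ℚ.+ 1/suc k) ∎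
  where
  open ℚₚ.≤-Reasoning
  a = ⌊log₂ m ℕ.^ suc j ⌋
  b = ⌊log₂ m ℕ.^ suc k ⌋
  split : mkℚᵘ (+ suc b) k ℚ.≃ mkℚᵘ (+ b) k ℚ.+ 1/suc k
  split = ℚ.*≡* (trans (sym (ℤₚ.pos-* (suc b) (suc k ℕ.* suc k)))
    (trans (cong +_ (lemma b (suc k)))
    (trans (ℤₚ.pos-* (b ℕ.* suc k ℕ.+ 1 ℕ.* suc k) (suc k))
      (cong (ℤ._* + suc k) (cong (ℤ._+ (+ 1 ℤ.* + suc k)) (ℤₚ.pos-* b (suc k)))))))
    where
    open import Data.Nat.Tactic.RingSolver using (solve-∀)
    lemma : ∀ b c → suc b ℕ.* (c ℕ.* c) ≡ (b ℕ.* c ℕ.+ 1 ℕ.* c) ℕ.* c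
    lemma = solve-∀

-- f = o(g), i.e. for every ε > 0, ∣ f n ∣ ≤ ε · g n for all large n.
-- Rational ε suffice, since every positive real exceeds a positive rational.
_∈o_ : (ℕ → ℝ) → (ℕ → ℕ) → Set
f ∈o g = ∀ (ε : ℚᵘ) → 0ℚᵘ ℚ.< ε → ∃[ N ] ∀ n → N ≤ n →
  fromℚ (ℚ.- (ε ℚ.* fromNat (g n))) ≤ᵣ f n × f n ≤ᵣ fromℚ (ε ℚ.* fromNat (g n))

------------------------------------------------------------------------
-- Graphs

record Graph (n : ℕ) : Set where
  field
    adj       : Fin n → Fin n → Bool
    symmetric : ∀ u v → adj u v ≡ adj v u
    loopless  : ∀ v → ¬ T (adj v v)

Adj : ∀ {n} → Graph n → Fin n → Fin n → Set
Adj G u v = T (Graph.adj G u v)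

GraphClass : Set₁
GraphClass = ∀ {n} → Graph n → Set

Independent Clique : ∀ {n} → Graph n → Subset n → Set
Independent G I = ∀ u v → u ∈ I → v ∈ I → ¬ Adj G u v
Clique      G C = ∀ u v → u ∈ C → v ∈ C → u ≢ v → Adj G u v

independent? : ∀ {n} (G : Graph n) → Decidable (Independent G)
independent? G I = all? λ u → all? λ v →
  (u ∈? I) →-dec (v ∈? I) →-dec ¬? (T? (Graph.adj G u v))

clique? : ∀ {n} (G : Graph n) → Decidable (Clique G)
clique? G C = all? λ u → all? λ v →
  (u ∈? C) →-dec (v ∈? C) →-dec ¬? (u ≟ᶠ v) →-dec T? (Graph.adj G u v)

------------------------------------------------------------------------
-- Independence number and clique cover number of an induced subgraph.
-- The subgraph of G induced by S is represented by the pair G, S.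

-- The greatest k ≤ b satisfying P, or 0 if there is none.
greatest : ∀ {P : Pred ℕ 0ℓ} → Decidable P → ℕ → ℕ
greatest P? zero    = zero
greatest P? (suc b) with P? (suc b)
... | yes _ = suc b
... | no  _ = greatest P? b

-- The least k ≤ b satisfying P, or b if there is none.
least : ∀ {P : Pred ℕ 0ℓ} → Decidable P → ℕ → ℕ
least P? zero    = zero
least P? (suc b) with P? 0
... | yes _ = 0
... | no  _ = suc (least (P? ∘ suc) b)

greatest-holds : ∀ {P : Pred ℕ 0ℓ} (P? : Decidable P) b → P 0 → P (greatest P? b)
greatest-holds P? zero    p = p
greatest-holds P? (suc b) p with P? (suc b)
... | yes q = q
... | no  _ = greatest-holds P? b p

greatest-bounds : ∀ {P : Pred ℕ 0ℓ} (P? : Decidable P) b {k} → P k → k ≤ b → k ≤ greatest P? b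
greatest-bounds P? zero    p k≤b = k≤b
greatest-bounds P? (suc b) p k≤b with P? (suc b) | ℕₚ.m≤n⇒m<n∨m≡n k≤b
... | yes _ | _              = k≤b
... | no  _ | inj₁ (s≤s k≤b) = greatest-bounds P? b p k≤b
... | no ¬q | inj₂ refl      = contradiction p ¬q

least-holds : ∀ {P : Pred ℕ 0ℓ} (P? : Decidable P) b → P b → P (least P? b)
least-holds P? zero    p = p
least-holds P? (suc b) p with P? 0
... | yes q = q
... | no  _ = least-holds (P? ∘ suc) b p

least-bounds : ∀ {P : Pred ℕ 0ℓ} (P? : Decidable P) b {k} → P k → least P? b ≤ k
least-bounds P? zero    p = z≤n
least-bounds P? (suc b) {k} p with P? 0
least-bounds P? (suc b) {k}     p | yes _ = z≤n
least-bounds P? (suc b) {zero}  p | no ¬q = contradiction p ¬q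
least-bounds P? (suc b) {suc k} p | no _  = s≤s (least-bounds (P? ∘ suc) b p)

HasIndependentSet : ∀ {n} → Graph n → Subset n → ℕ → Set
HasIndependentSet {n} G S k = Σ (Subset n) λ I → I ⊆ S × Independent G I × ∣ I ∣ ≡ k

hasIndependentSet? : ∀ {n} (G : Graph n) S → Decidable (HasIndependentSet G S)
hasIndependentSet? G S k =
  anySubset? λ I → (I ⊆? S) ×-dec independent? G I ×-dec (∣ I ∣ ℕₚ.≟ k)

α : ∀ {n} → Graph n → Subset n → ℕ
α {n} G S = greatest (hasIndependentSet? G S) n

α-attained : ∀ {n} (G : Graph n) S → HasIndependentSet G S (α G S)
α-attained {n} G S = greatest-holds (hasIndependentSet? G S) n
  (∅ , ⊥⊆ , (λ u v u∈∅ → contradiction u∈∅ ∉⊥) , ∣⊥∣≡0 n)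

α-maximal : ∀ {n} (G : Graph n) S {I} → I ⊆ S → Independent G I → ∣ I ∣ ≤ α G S
α-maximal {n} G S {I} I⊆S ind =
  greatest-bounds (hasIndependentSet? G S) n (I , I⊆S , ind , refl) (∣p∣≤n I)

-- The equation makes the k cliques cover S and lie inside S.  They may be
-- empty or overlap, which does not affect the least possible k.
HasCliqueCover : ∀ {n} → Graph n → Subset n → ℕ → Set
HasCliqueCover {n} G S k = Σ (Vec (Subset n) k) λ Cs → All (Clique G) Cs × ⋃ (toList Cs) ≡ S

private
  anyVec? : ∀ {n} k {P : Pred (Vec (Subset n) k) 0ℓ} → Decidable P → Dec (∃ P)
  anyVec? zero    P? = map′ (λ p → [] , p) (λ { ([] , p) → p }) (P? [])
  anyVec? (suc k) P? = map′ (λ { (C , Cs , p) → C ∷ Cs , p }) (λ { (C ∷ Cs , p) → C , Cs , p })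
    (anySubset? λ C → anyVec? k λ Cs → P? (C ∷ Cs))

  ∈⋃⁺ : ∀ {n} k (f : Fin k → Subset n) {x} i → x ∈ f i → x ∈ ⋃ (toList (tabulate f))
  ∈⋃⁺ (suc k) f zero    x∈ = x∈p∪q⁺ (inj₁ x∈)
  ∈⋃⁺ (suc k) f (suc i) x∈ = x∈p∪q⁺ (inj₂ (∈⋃⁺ k (f ∘ suc) i x∈))

  ∈⋃⁻ : ∀ {n} k (f : Fin k → Subset n) {x} → x ∈ ⋃ (toList (tabulate f)) → ∃[ i ] x ∈ f i
  ∈⋃⁻ zero    f x∈ = contradiction x∈ ∉⊥
  ∈⋃⁻ (suc k) f x∈ with x∈p∪q⁻ _ _ x∈
  ... | inj₁ x∈₀ = zero , x∈₀
  ... | inj₂ x∈₊ with ∈⋃⁻ k (f ∘ suc) x∈₊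
  ...   | i , x∈ᵢ = suc i , x∈ᵢ

  singletons : ∀ {n} (G : Graph n) S → HasCliqueCover G S n
  singletons {n} G S = tabulate piece , tabulate⁺ clique , ⊆-antisym
    (λ x∈ → proj₁ (x∈p∩q⁻ S _ (proj₂ (∈⋃⁻ n piece x∈))))
    (λ {x} x∈S → ∈⋃⁺ n piece x (x∈p∩q⁺ (x∈S , x∈⁅x⁆ x)))
    where
    piece : Fin n → Subset n
    piece v = S ∩ ⁅ v ⁆
    clique : ∀ v → Clique G (piece v)
    clique v x y x∈ y∈ x≢y = contradiction
      (trans (x∈⁅y⁆⇒x≡y v (proj₂ (x∈p∩q⁻ S _ x∈)))
        (sym (x∈⁅y⁆⇒x≡y v (proj₂ (x∈p∩q⁻ S _ y∈))))) x≢y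

hasCliqueCover? : ∀ {n} (G : Graph n) S → Decidable (HasCliqueCover G S)
hasCliqueCover? G S k =
  anyVec? k λ Cs → allᵛ? (clique? G) Cs ×-dec ≡-dec _≟ᵇ_ (⋃ (toList Cs)) S

-- Singletons show that n cliques always suffice.
θ : ∀ {n} → Graph n → Subset n → ℕ
θ {n} G S = least (hasCliqueCover? G S) n

θ-attained : ∀ {n} (G : Graph n) S → HasCliqueCover G S (θ G S)
θ-attained {n} G S = least-holds (hasCliqueCover? G S) n (singletons G S)

θ-minimal : ∀ {n} (G : Graph n) S {k} → HasCliqueCover G S k → θ G S ≤ k
θ-minimal {n} G S = least-bounds (hasCliqueCover? G S) n

------------------------------------------------------------------------
-- Clique-based separators

record Separation {n} (G : Graph n) : Set where
  field
    A B    : Subset n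
    covers : A ∪ B ≡ ⊤
    noEdge : ∀ u v → u ∈ A ─ B → v ∈ B ─ A → ¬ Adj G u v

Balanced : ∀ {n} {G : Graph n} → ℝ → Separation G → Set
Balanced {n} β s = fromNatᵣ (∣ A ─ B ∣ ⊔ ∣ B ─ A ∣) ≤ᵣ n · β
  where open Separation s

record CliqueBasedSeparator {n} (β : ℝ) (G : Graph n) : Set where
  field
    cliques    : List (Subset n)
    areCliques : List.All (Clique G) cliques
    disjoint   : AllPairs (λ C D → Empty (C ∩ D)) cliques
    separation : Separation G
    balanced   : Balanced β separation
    union      : ⋃ cliques ≡ Separation.A separation ∩ Separation.B separation

  weight : ℝ
  weight = foldr (λ C w → log₂ (suc ∣ C ∣) +ᵣ w) (fromNatᵣ 0) cliques

open CliqueBasedSeparator public using (weight)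

Property : Set₁
Property = GraphClass → Set

-- The base of the logarithm is immaterial for sublinearity.
SublinearCliqueBasedSeparators : Property
SublinearCliqueBasedSeparators 𝒢 =
  ∃[ β ] β <ᵣ fromNatᵣ 1 × ∃[ w ] w ∈o (λ n → n) ×
    (∀ {n} (G : Graph n) → 𝒢 G → Σ (CliqueBasedSeparator β G) λ 𝒮 → weight 𝒮 ≤ᵣ w n)

------------------------------------------------------------------------
-- θ-binding functions

_IsθBindingFunctionFor_ : (ℕ → ℝ) → GraphClass → Set
f IsθBindingFunctionFor 𝒢 =
  ∀ {n} (G : Graph n) → 𝒢 G → (S : Subset n) → fromNatᵣ (θ G S) ≤ᵣ f (α G S)

SubquadraticθBindingFunction : Property
SubquadraticθBindingFunction 𝒢 =
  ∃[ f ] f IsθBindingFunctionFor 𝒢 × f ∈o (λ x → x ℕ.^ 2)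

------------------------------------------------------------------------
-- Tree decompositions and layerings

-- The vertices satisfying P induce a connected (possibly empty) subgraph.
ConnectedOn : ∀ {n} → Graph n → Pred (Fin n) 0ℓ → Set
ConnectedOn G P = ∀ {s t} → P s → P t → Star (λ a b → P a × P b × Adj G a b) s t

-- A cycle of length 3 + k.
record Cycle {n} (G : Graph n) : Set where
  field
    k        : ℕ
    vertex   : Fin (3 ℕ.+ k) → Fin n
    distinct : Injective _≡_ _≡_ vertex
    step     : ∀ i → Adj G (vertex (inject₁ i)) (vertex (suc i))
    close    : Adj G (vertex (fromℕ (2 ℕ.+ k))) (vertex zero)

record IsTree {m} (T : Graph m) : Set where
  field
    nonEmpty  : NonZero m
    connected : ConnectedOn T U
    acyclic   : ¬ Cycle T

record TreeDecomposition {n} (G : Graph n) : Set where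
  field
    {m}       : ℕ
    tree      : Graph m
    isTree    : IsTree tree
    bag       : Fin m → Subset n
    vertices  : ∀ v → ∃[ t ] v ∈ bag t
    edges     : ∀ u v → Adj G u v → ∃[ t ] u ∈ bag t × v ∈ bag t
    subtree   : ∀ v → ConnectedOn tree (λ t → v ∈ bag t)

  Node : Set
  Node = Fin m

-- The ordered partition is given by the index of the part of each vertex.
record Layering {n} (G : Graph n) : Set where
  field
    index    : Fin n → ℕ
    adjacent : ∀ u v → Adj G u v → ∣ index u - index v ∣ ≤ 1

  layer : ℕ → Subset n
  layer i = tabulate λ v → ⌊ index v ℕₚ.≟ i ⌋

open TreeDecomposition public using (Node; bag)
open Layering public using (layer)

TreeIndependenceNumber≤ LayeredTreewidth≤ LayeredTreeIndependenceNumber≤ :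
  ℕ → ∀ {n} → Graph n → Set

TreeIndependenceNumber≤ ℓ G =
  Σ (TreeDecomposition G) λ D → ∀ (t : Node D) → α G (bag D t) ≤ ℓ

LayeredTreewidth≤ ℓ G =
  Σ (TreeDecomposition G) λ D → Σ (Layering G) λ L →
    ∀ (t : Node D) i → ∣ bag D t ∩ layer L i ∣ ≤ ℓ

LayeredTreeIndependenceNumber≤ ℓ G =
  Σ (TreeDecomposition G) λ D → Σ (Layering G) λ L →
    ∀ (t : Node D) i → α G (bag D t ∩ layer L i) ≤ ℓ

Bounded : (ℕ → ∀ {n} → Graph n → Set) → Property
Bounded Param≤ 𝒢 = ∃[ ℓ ] ∀ {n} (G : Graph n) → 𝒢 G → Param≤ ℓ G

BoundedTreeIndependenceNumber BoundedLayeredTreewidth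
  BoundedLayeredTreeIndependenceNumber : Property
BoundedTreeIndependenceNumber        = Bounded TreeIndependenceNumber≤
BoundedLayeredTreewidth              = Bounded LayeredTreewidth≤
BoundedLayeredTreeIndependenceNumber = Bounded LayeredTreeIndependenceNumber≤

------------------------------------------------------------------------
-- Relations between properties of graph classes

infixr 6 _And_
infix  4 _Implies_ _IncomparableTo_

_And_ : Property → Property → Property
(P And Q) 𝒢 = P 𝒢 × Q 𝒢

_Implies_ : Property → Property → Set₁
P Implies Q = ∀ (𝒢 : GraphClass) → P 𝒢 → Q 𝒢

_IncomparableTo_ : Property → Property → Set₁
P IncomparableTo Q = ¬ (P Implies Q) × ¬ (Q Implies P)

module Submission where

-- All three implications follow from bounded layered tree-independence number alone.  Some node of
-- a tree decomposition has a bag X such that every component of G - X has at most n/2 vertices.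
-- For p = 2 ^ e, delete a sparsest residue class R of layers modulo p and, from the median slab
-- between deleted layers, the part Y of X in it.  The components left have at most n/2 vertices, so
-- they can be grouped into a 3/4-balanced separation.  The set R is covered by n/p singletons.
-- Independent sets in Y have at most p ℓ vertices, so by Ramsey's theorem Y can be partitioned into
-- cliques of size 2 ^ e and a number of singletons depending only on e.  The total weight is
-- at most n (e + 2) / 2 ^ e plus that number, hence sublinear when e tends slowly to infinity.
--
-- Balanced bags also show that grids have unbounded tree-independence number and that complete
-- graphs have unbounded layered treewidth.  Complements of shift graphs have α ≤ 2 but unbounded θ.

open import Defs
open import Data.Bool.Base using (Bool; true; false; T; not)
open import Data.Bool.Properties using (T?; T-≡; not-¬) renaming (_≟_ to _≟ᵇ_)
open import Data.Empty using () renaming (⊥ to Absurd)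
open import Data.Fin.Base as Fin
  using (Fin; zero; suc; toℕ; fromℕ; fromℕ<; inject₁; combine; remQuot; funToFin; finToFun)
open import Data.Fin.Properties as Finₚ
  using (any?; ¬∀⟶∃¬; injective⇒≤; toℕ-injective; toℕ-inject₁; toℕ-fromℕ<;
         remQuot-combine; combine-remQuot; finToFun-funToFin)
  renaming (_≟_ to _≟ᶠ_)
open import Data.Fin.Relation.Unary.Top using (view; ‵fromℕ; ‵inject₁)
open import Data.Fin.Subset hiding (_-_)
open import Data.Fin.Subset.Properties
open import Data.Integer.Base as ℤ using (-[1+_]; +[1+_]) renaming (+_ to pos)
import Data.Integer.Properties as ℤₚ
open import Data.List.Base using (List; []; _∷_; foldr)
import Data.List.Relation.Unary.All as List
open import Data.List.Relation.Unary.AllPairs using (AllPairs; []; _∷_)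
open import Data.Nat.Base as ℕ
  using (ℕ; zero; suc; NonZero; z≤n; s≤s; _≤_; _<_; _+_; _*_; _∸_; _^_; _⊔_; ∣_-_∣)
open import Data.Nat.DivMod
open import Data.Nat.Logarithm using (⌊log₂_⌋; ⌊log₂⌋-mono-≤; ⌊log₂[2^n]⌋≡n)
import Data.Nat.Properties as ℕₚ
open import Data.Nat.Tactic.RingSolver using (solve-∀)
open import Data.Product.Base using (Σ; ∃; ∃-syntax; _×_; _,_; proj₁; proj₂)
open import Data.Rational.Unnormalised.Base as ℚ using (ℚᵘ; mkℚᵘ)
import Data.Rational.Unnormalised.Properties as ℚₚ
open import Data.Sum.Base using (_⊎_; inj₁; inj₂; [_,_]′; swap)
open import Data.Unit.Base using (tt)
open import Data.Vec.Base using (Vec; []; _∷_; here; there; lookup; tabulate; toList)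
import Data.Vec.Membership.DecPropositional as DecMembership
open import Data.Vec.Membership.Propositional using () renaming (_∈_ to _∈ᵛ_; _∉_ to _∉ᵛ_)
open import Data.Vec.Membership.Propositional.Properties using (∈-lookup)
open import Data.Vec.Properties using (lookup∘tabulate; lookup⇒[]=; []=⇒lookup)
open import Data.Vec.Relation.Unary.All using (All; []; _∷_)
open import Data.Vec.Relation.Unary.Any using (here; there)
open import Function.Base using (_∘_; id)
open import Function.Bundles using (Equivalence)
open import Function.Definitions using (Injective)
open import Level using (0ℓ)
open import Relation.Binary.Construct.Closure.ReflexiveTransitive using (Star; ε; _◅_; _◅◅_; reverse)
open import Relation.Binary.Definitions using (tri<; tri≈; tri>)
open import Relation.Binary.PropositionalEquality
open import Relation.Nullary using (¬_; Dec; yes; no; contradiction)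
open import Relation.Nullary.Decidable
  using (⌊_⌋; ¬?; _×-dec_; _⊎-dec_; toWitness; fromWitness; decidable-stable)
open import Relation.Unary using (Pred; Decidable; U)

-- Subsets of Fin n

-- A bag may meet arbitrarily many layers, so its independence number is unbounded; this is why the
-- layers are cut before the bag is used. The slabs before the median one carry at most half of the
-- vertices, and so do those after it, so the bag has to be removed inside one slab only. The number
-- of cliques in a partition of `Y` cannot be controlled through independence numbers, as `coShift`
-- shows. What is controlled is the weight per vertex: a clique on 2 ^ e vertices weighs at most e +
-- 1, that is (e + 1) / 2 ^ e for each of its vertices. The price is a Ramsey number of leftover
-- vertices, which depends on e and ℓ only; letting e grow slowly enough with n absorbs it. The
-- estimates are multiplied by 2 ^ e and kept in the natural numbers; reals enter only when
-- logarithms are compared with these bounds.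

private variable
  n : ℕ

select : {P : Pred (Fin n) 0ℓ} → Decidable P → Subset n
select P? = tabulate λ x → ⌊ P? x ⌋

∈-select⁺ : {P : Pred (Fin n) 0ℓ} (P? : Decidable P) → ∀ {x} → P x → x ∈ select P?
∈-select⁺ P? {x} px = lookup⇒[]= x _
  (trans (lookup∘tabulate _ x) (Equivalence.to T-≡ (fromWitness px)))

∈-select⁻ : {P : Pred (Fin n) 0ℓ} (P? : Decidable P) → ∀ {x} → x ∈ select P? → P x
∈-select⁻ P? {x} x∈ = toWitness
  (Equivalence.from T-≡ (trans (sym (lookup∘tabulate _ x)) ([]=⇒lookup x∈)))

x∈p─q⁻ : ∀ (p q : Subset n) {x} → x ∈ p ─ q → x ∈ p × x ∉ q
x∈p─q⁻ (_ ∷ p) (false ∷ q) here       = here , λ ()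
x∈p─q⁻ (_ ∷ p) (_ ∷ q)     (there x∈) with x∈p─q⁻ p q x∈
... | x∈p , x∉q = there x∈p , λ { (there x∈q) → x∉q x∈q }

∣p∪q∣≤∣p∣+∣q∣ : ∀ (p q : Subset n) → ∣ p ∪ q ∣ ≤ ∣ p ∣ + ∣ q ∣
∣p∪q∣≤∣p∣+∣q∣ []          []          = z≤n
∣p∪q∣≤∣p∣+∣q∣ (false ∷ p) (false ∷ q) = ∣p∪q∣≤∣p∣+∣q∣ p q
∣p∪q∣≤∣p∣+∣q∣ (false ∷ p) (true ∷ q)  =
  ℕₚ.≤-trans (s≤s (∣p∪q∣≤∣p∣+∣q∣ p q)) (ℕₚ.≤-reflexive (sym (ℕₚ.+-suc ∣ p ∣ ∣ q ∣)))
∣p∪q∣≤∣p∣+∣q∣ (true ∷ p)  (y ∷ q)     =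
  s≤s (ℕₚ.≤-trans (∣p∪q∣≤∣p∣+∣q∣ p q) (ℕₚ.+-monoʳ-≤ ∣ p ∣ (∣p∣≤∣x∷p∣ y q)))

∣p∣≤∣q∣+∣r∣ : ∀ {p q r : Subset n} → (∀ {x} → x ∈ p → x ∈ q ⊎ x ∈ r) → ∣ p ∣ ≤ ∣ q ∣ + ∣ r ∣
∣p∣≤∣q∣+∣r∣ {q = q} {r} cover =
  ℕₚ.≤-trans (p⊆q⇒∣p∣≤∣q∣ (x∈p∪q⁺ ∘ cover)) (∣p∪q∣≤∣p∣+∣q∣ q r)

∣p∣+∣q∣≤∣p∪q∣ : ∀ (p q : Subset n) → Empty (p ∩ q) → ∣ p ∣ + ∣ q ∣ ≤ ∣ p ∪ q ∣
∣p∣+∣q∣≤∣p∪q∣ []          []          _ = z≤n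
∣p∣+∣q∣≤∣p∪q∣ (true ∷ p)  (true ∷ q)  e = contradiction (zero , here) e
∣p∣+∣q∣≤∣p∪q∣ (true ∷ p)  (false ∷ q) e = s≤s (∣p∣+∣q∣≤∣p∪q∣ p q (drop-∷-Empty e))
∣p∣+∣q∣≤∣p∪q∣ (false ∷ p) (false ∷ q) e = ∣p∣+∣q∣≤∣p∪q∣ p q (drop-∷-Empty e)
∣p∣+∣q∣≤∣p∪q∣ (false ∷ p) (true ∷ q)  e = ℕₚ.≤-trans
  (ℕₚ.≤-reflexive (ℕₚ.+-suc ∣ p ∣ ∣ q ∣)) (s≤s (∣p∣+∣q∣≤∣p∪q∣ p q (drop-∷-Empty e)))

∣q∣+∣r∣≤∣p∣ : ∀ {p q r : Subset n} → q ⊆ p → r ⊆ p → (∀ {x} → x ∈ q → x ∉ r) →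
              ∣ q ∣ + ∣ r ∣ ≤ ∣ p ∣
∣q∣+∣r∣≤∣p∣ {p = p} {q} {r} q⊆p r⊆p disjoint = ℕₚ.≤-trans
  (∣p∣+∣q∣≤∣p∪q∣ q r λ (x , x∈) → let x∈q , x∈r = x∈p∩q⁻ q r x∈ in disjoint x∈q x∈r)
  (p⊆q⇒∣p∣≤∣q∣ λ x∈ → [ q⊆p , r⊆p ]′ (x∈p∪q⁻ q r x∈))

∣p∣≤1 : ∀ (p : Subset n) → (∀ {x y} → x ∈ p → y ∈ p → x ≡ y) → ∣ p ∣ ≤ 1
∣p∣≤1 {n} p unique with nonempty? p
... | no  empty   = ℕₚ.≤-trans (p⊆q⇒∣p∣≤∣q∣ {q = ⊥} λ x∈ → contradiction (_ , x∈) empty)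
                      (ℕₚ.≤-trans (ℕₚ.≤-reflexive (∣⊥∣≡0 n)) z≤n)
... | yes (x , x∈) = ℕₚ.≤-trans
  (p⊆q⇒∣p∣≤∣q∣ {q = ⁅ x ⁆} λ {y} y∈ → subst (_∈ ⁅ x ⁆) (unique x∈ y∈) (x∈⁅x⁆ x))
  (ℕₚ.≤-reflexive (∣⁅x⁆∣≡1 x))

cover-bound : ∀ {m k} (p : Subset n) (q : Subset m) (F : Fin m → Subset n) →
              (∀ {x} → x ∈ p → ∃[ u ] u ∈ q × x ∈ F u) → (∀ u → ∣ F u ∣ ≤ k) →
              ∣ p ∣ ≤ ∣ q ∣ * k
cover-bound {n = n} p [] F cover small = ℕₚ.≤-reflexive (trans (cong ∣_∣ (Empty-unique empty)) (∣⊥∣≡0 n))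
  where
  empty : Empty p
  empty (x , x∈) with cover x∈
  ... | () , _
cover-bound {k = k} p (b ∷ q) F cover small with b
... | false = cover-bound p q (F ∘ suc) cover′ (small ∘ suc)
  where
  cover′ : ∀ {x} → x ∈ p → ∃[ u ] u ∈ q × x ∈ F (suc u)
  cover′ x∈ with cover x∈
  ... | suc u , there u∈ , x∈F = u , u∈ , x∈F
... | true = begin
  ∣ p ∣                        ≤⟨ ∣p∣≤∣q∣+∣r∣ split ⟩
  ∣ F zero ∣ + ∣ p ─ F zero ∣   ≤⟨ ℕₚ.+-mono-≤ (small zero)
                                   (cover-bound (p ─ F zero) q (F ∘ suc) cover′ (small ∘ suc)) ⟩
  k + ∣ q ∣ * k                ∎
  where
  open ℕₚ.≤-Reasoning
  split : ∀ {x} → x ∈ p → x ∈ F zero ⊎ x ∈ p ─ F zero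
  split {x} x∈ with x ∈? F zero
  ... | yes x∈F = inj₁ x∈F
  ... | no  x∉F = inj₂ (x∈p∧x∉q⇒x∈p─q x∈ x∉F)
  cover′ : ∀ {x} → x ∈ p ─ F zero → ∃[ u ] u ∈ q × x ∈ F (suc u)
  cover′ x∈ with x∈p─q⁻ p (F zero) x∈
  ... | x∈p , x∉F with cover x∈p
  ...   | zero  , _        , x∈F = contradiction x∈F x∉F
  ...   | suc u , there u∈ , x∈F = u , u∈ , x∈F

-- Discrete intermediate value principle. In its uses `K` exceeds all labels, so the first
-- alternative says that the condition still holds once every vertex has been counted.
crossing : ∀ {P : Pred ℕ 0ℓ} → Decidable P → P 0 → ∀ K →
           P K ⊎ (∃[ k ] P k × ¬ P (suc k))
crossing P? p0 zero    = inj₁ p0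
crossing P? p0 (suc K) with crossing P? p0 K
... | inj₂ q = inj₂ q
... | inj₁ pK with P? (suc K)
...   | yes p = inj₁ p
...   | no ¬p = inj₂ (K , pK , ¬p)

bounded : ∀ {n} (f : Fin n → ℕ) → ∃[ K ] ∀ x → f x < K
bounded {zero}  f = 0 , λ ()
bounded {suc n} f with bounded (f ∘ suc)
... | K , f<K = suc (f zero) ⊔ K , λ
  { zero    → ℕₚ.m≤m⊔n _ K
  ; (suc x) → ℕₚ.<-≤-trans (f<K x) (ℕₚ.m≤n⊔m _ K) }

-- Tree decompositions: rooting the tree, and balanced bags

module _ {m : ℕ} where
  open DecMembership (_≟ᶠ_ {m}) using () renaming (_∈?_ to _∈ᵛ?_)

  -- The vector of vertices is an index, so that `lookup` can serve as the vertex function of a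
  -- `Cycle`.
  data Path (R : Fin m → Fin m → Set) : ∀ {l} → Fin m → Vec (Fin m) (suc l) → Fin m → Set where
    end  : ∀ {x} → Path R x (x ∷ []) x
    cons : ∀ {l x y z} {ys : Vec (Fin m) (suc l)} →
           R x y → x ∉ᵛ ys → Path R y ys z → Path R x (x ∷ ys) z

  module _ {R : Fin m → Fin m → Set} where
    suffix : ∀ {l x y z} {ys : Vec (Fin m) (suc l)} → Path R y ys z → x ∈ᵛ ys →
             ∃[ l′ ] Σ (Vec (Fin m) (suc l′)) λ xs → Path R x xs z
    suffix end            (here refl) = _ , _ , end
    suffix (cons r y∉ p) (here refl) = _ , _ , cons r y∉ p
    suffix (cons _ _  p) (there x∈)  = suffix p x∈

    loop-erase : ∀ {x z} → Star R x z → ∃[ l ] Σ (Vec (Fin m) (suc l)) λ xs → Path R x xs z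
    loop-erase ε = _ , _ , end
    loop-erase {x} (r ◅ rs) with loop-erase rs
    ... | _ , ys , p with x ∈ᵛ? ys
    ...   | yes x∈ = suffix p x∈
    ...   | no  x∉ = _ , _ , cons r x∉ p

    path-injective : ∀ {l x z} {xs : Vec (Fin m) (suc l)} → Path R x xs z →
                     Injective _≡_ _≡_ (lookup xs)
    path-injective end          {zero}  {zero}  _  = refl
    path-injective (cons _ _ _) {zero}  {zero}  _  = refl
    path-injective (cons {ys = ys} _ x∉ _) {zero}  {suc j} eq =
      contradiction (subst (_∈ᵛ ys) (sym eq) (∈-lookup j ys)) x∉
    path-injective (cons {ys = ys} _ x∉ _) {suc i} {zero}  eq =
      contradiction (subst (_∈ᵛ ys) eq (∈-lookup i ys)) x∉
    path-injective (cons _ _ p) {suc i} {suc j} eq = cong suc (path-injective p eq)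

    path-first : ∀ {l x z} {xs : Vec (Fin m) (suc l)} → Path R x xs z → lookup xs zero ≡ x
    path-first end          = refl
    path-first (cons _ _ _) = refl

    path-last : ∀ {l x z} {xs : Vec (Fin m) (suc l)} → Path R x xs z → lookup xs (fromℕ l) ≡ z
    path-last end          = refl
    path-last (cons _ _ p) = path-last p

    path-step : ∀ {l x z} {xs : Vec (Fin m) (suc l)} → Path R x xs z →
                ∀ i → R (lookup xs (inject₁ i)) (lookup xs (suc i))
    path-step (cons r _ p) zero    = subst (R _) (sym (path-first p)) r
    path-step (cons _ _ p) (suc i) = path-step p i

Adj-sym : ∀ {n} (G : Graph n) {u v} → Adj G u v → Adj G v u
Adj-sym G {u} {v} = subst T (Graph.symmetric G u v)

module Rooted {m} (T : Graph m) (isTree : IsTree T) where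
  open IsTree isTree

  -- An edge s t outside R would close an R-path from s to t to a cycle.
  edge-in : (R : Fin m → Fin m → Set) → (∀ {s t} → R s t → Adj T s t) →
            ∀ {s t} → Adj T s t → Star R s t → R s t
  edge-in R R⇒Adj {s} st walk with loop-erase walk
  ... | _ , _ , end                  = contradiction st (Graph.loopless T s)
  -- A path with a single step is the wanted `R s t` itself; any longer one has at least three
  -- vertices and closes up to a cycle.
  ... | _ , _ , cons r _ end         = r
  ... | suc (suc k) , xs , p = contradiction cycle acyclic
    where
    cycle : Cycle T
    cycle .Cycle.k        = k
    cycle .Cycle.vertex   = lookup xs
    cycle .Cycle.distinct = path-injective p
    cycle .Cycle.step i   = R⇒Adj (path-step p i)
    cycle .Cycle.close    = subst₂ (Adj T) (sym (path-last p)) (sym (path-first p)) (Adj-sym T st)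

  root : Fin m
  root = first nonEmpty
    where
    first : ∀ {m} → NonZero m → Fin m
    first {suc m} _ = zero

  Reach : ℕ → Fin m → Set
  Reach zero    t = t ≡ root
  Reach (suc k) t = ∃[ s ] Adj T s t × Reach k s

  reach? : ∀ k → Decidable (Reach k)
  reach? zero    t = t ≟ᶠ root
  reach? (suc k) t = any? λ s → T? _ ×-dec reach? k s

  reachable : ∀ t → ∃[ k ] Reach k t
  reachable t = go 0 refl (connected {root} {t} tt tt)
    where
    go : ∀ k {s} → Reach k s → Star (λ a b → U a × U b × Adj T a b) s t → ∃[ k ] Reach k t
    go k r ε                      = k , r
    go k r ((_ , _ , st) ◅ walk) = go (suc k) (_ , st , r) walk

  depth : Fin m → ℕ
  depth t = least (λ k → reach? k t) (proj₁ (reachable t))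

  reach-depth : ∀ t → Reach (depth t) t
  reach-depth t = least-holds (λ k → reach? k t) _ (proj₂ (reachable t))

  depth-least : ∀ {k t} → Reach k t → depth t ≤ k
  depth-least {t = t} = least-bounds (λ k → reach? k t) (proj₁ (reachable t))

  depth≡0⇒root : ∀ {t} → depth t ≡ 0 → t ≡ root
  depth≡0⇒root {t} eq = subst (λ k → Reach k t) eq (reach-depth t)

  hasParent : ∀ {k t} → depth t ≡ suc k → ∃[ s ] Adj T s t × depth s ≡ k
  hasParent {k} {t} eq with subst (λ k → Reach k t) eq (reach-depth t)
  ... | s , st , r = s , st , ℕₚ.≤-antisym (depth-least r)
    (ℕ.s≤s⁻¹ (subst (_≤ _) eq (depth-least {suc (depth s)} (s , st , reach-depth s))))

  -- The depth and its equation are arguments, so that a case split on the depth keeps the equation.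
  -- A node of depth 0 is returned unchanged, as a default.
  parentAt : ∀ t d → depth t ≡ d → Fin m
  parentAt t zero    _  = t
  parentAt t (suc k) eq = proj₁ (hasParent eq)

  parent : Fin m → Fin m
  parent t = parentAt t (depth t) refl

  parent-spec : ∀ {k t} → depth t ≡ suc k → Adj T (parent t) t × depth (parent t) ≡ k
  parent-spec {k} {t} = go (depth t) refl
    where
    go : ∀ d (eq : depth t ≡ d) → d ≡ suc k →
         Adj T (parentAt t d eq) t × depth (parentAt t d eq) ≡ k
    go (suc k) eq refl = proj₂ (hasParent eq)

  ParentEdge : Fin m → Fin m → Set
  ParentEdge s t = (∃[ k ] depth t ≡ suc k) × s ≡ parent t

  Edge : Fin m → Fin m → Set
  Edge s t = ParentEdge s t ⊎ ParentEdge t s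

  to-root : ∀ d {t} → depth t ≡ d → Star Edge t root
  to-root zero    eq = subst (Star Edge _) (depth≡0⇒root eq) ε
  to-root (suc d) eq = inj₂ ((d , eq) , refl) ◅ to-root d (proj₂ (parent-spec eq))

  Edge⇒Adj : ∀ {s t} → Edge s t → Adj T s t
  Edge⇒Adj (inj₁ ((_ , eq) , refl)) = proj₁ (parent-spec eq)
  Edge⇒Adj (inj₂ ((_ , eq) , refl)) = Adj-sym T (proj₁ (parent-spec eq))

  -- Parent edges already join every node to the root, hence any two nodes to each other, so
  -- `edge-in` leaves no room for a further edge.
  Adj⇒Edge : ∀ {s t} → Adj T s t → Edge s t
  Adj⇒Edge st = edge-in Edge Edge⇒Adj st
    (to-root _ refl ◅◅ reverse swap (to-root _ refl))

  up : ℕ → Fin m → Fin m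
  up zero    t = t
  up (suc k) t = up k (parent t)

  up-suc : ∀ k t → up (suc k) t ≡ parent (up k t)
  up-suc zero    t = refl
  up-suc (suc k) t = up-suc k (parent t)

  depth-up : ∀ k {d t} → depth t ≡ k + d → depth (up k t) ≡ d
  depth-up zero    eq = eq
  depth-up (suc k) eq = depth-up k (proj₂ (parent-spec eq))

  -- Below c t: t lies in the subtree rooted at c.
  Below : Fin m → Fin m → Set
  Below c t = depth c ≤ depth t × up (depth t ∸ depth c) t ≡ c

  below? : ∀ c → Decidable (Below c)
  below? c t = (depth c ℕₚ.≤? depth t) ×-dec (up (depth t ∸ depth c) t ≟ᶠ c)

  below-root : ∀ t → Below root t
  below-root t = subst (_≤ depth t) (sym depth-root) z≤n ,
    subst (λ d → up (depth t ∸ d) t ≡ root) (sym depth-root)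
      (depth≡0⇒root (depth-up (depth t) (sym (ℕₚ.+-identityʳ (depth t)))))
    where
    depth-root : depth root ≡ 0
    depth-root = ℕₚ.n≤0⇒n≡0 (depth-least refl)

  module Branches (s : Fin m) where
    -- The ancestor of t one level below s (junk unless t is deeper than s).
    branchTop : Fin m → Fin m
    branchTop t = up (depth t ∸ suc (depth s)) t

    InBranch : Fin m → Set
    InBranch t = depth s < depth t × parent (branchTop t) ≡ s

    inBranch? : Decidable InBranch
    inBranch? t = (depth s ℕₚ.<? depth t) ×-dec (parent (branchTop t) ≟ᶠ s)

    -- Names the component of T - s containing t: 0 for the part outside the subtree at s.
    branch : Fin m → ℕ
    branch t with inBranch? t
    ... | yes _ = suc (toℕ (branchTop t))
    ... | no  _ = 0

    branch-yes : ∀ {t} → InBranch t → branch t ≡ suc (toℕ (branchTop t))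
    branch-yes {t} b with inBranch? t
    ... | yes _ = refl
    ... | no ¬b = contradiction b ¬b

    branch-no : ∀ {t} → ¬ InBranch t → branch t ≡ 0
    branch-no {t} ¬b with inBranch? t
    ... | yes b = contradiction b ¬b
    ... | no  _ = refl

    -- If `parent t` is deeper than `s`, both nodes have the same ancestor one level below `s`.
    -- Otherwise both get 0: `parent t` is not deeper than `s`, and if `t` is deeper, then its
    -- parent is at the level of `s` without being `s`.
    branch-parent : ∀ {t k} → t ≢ s → parent t ≢ s → depth t ≡ suc k → branch t ≡ branch (parent t)
    branch-parent {t} {k} t≢s p≢s eq with ℕₚ.<-cmp (depth s) k
    ... | tri< s<k _ _ = cases (inBranch? t)
      where
      depthp = proj₂ (parent-spec eq)
      top≡ : branchTop t ≡ branchTop (parent t)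
      top≡ = trans (cong (λ j → up j t) (trans (cong (_∸ suc (depth s)) eq) (ℕₚ.+-∸-assoc 1 s<k)))
                   (cong (λ j → up (j ∸ suc (depth s)) (parent t)) (sym depthp))
      cases : Dec (InBranch t) → branch t ≡ branch (parent t)
      cases (yes b@(_ , e)) = trans (branch-yes b) (trans (cong (suc ∘ toℕ) top≡)
        (sym (branch-yes (subst (depth s <_) (sym depthp) s<k , trans (cong parent (sym top≡)) e))))
      cases (no ¬b) = trans (branch-no ¬b) (sym (branch-no λ (_ , e) →
        ¬b (subst (depth s <_) (sym eq) (ℕₚ.m≤n⇒m≤1+n s<k) , trans (cong parent top≡) e)))
    ... | tri≈ _ refl _ = trans
      (branch-no λ (_ , e) → p≢s (trans (cong parent (sym (cong (λ j → up j t)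
        (trans (cong (_∸ suc (depth s)) eq) (ℕₚ.n∸n≡0 (depth s)))))) e))
      (sym (branch-no λ (lt , _) → ℕₚ.<-irrefl (sym (proj₂ (parent-spec eq))) lt))
    ... | tri> _ _ k<s = trans
      (branch-no λ (lt , _) → ℕₚ.<⇒≱ (subst (depth s <_) eq lt) k<s)
      (sym (branch-no λ (lt , _) → ℕₚ.<-asym k<s (subst (depth s <_) (proj₂ (parent-spec eq)) lt)))

    branch-adj : ∀ {t t′} → t ≢ s → t′ ≢ s → Adj T t t′ → branch t ≡ branch t′
    branch-adj t≢s t′≢s e with Adj⇒Edge e
    ... | inj₁ ((_ , eq) , refl) = sym (branch-parent t′≢s t≢s eq)
    ... | inj₂ ((_ , eq) , refl) = branch-parent t≢s t′≢s eq

    branch≡0⇒¬below : ∀ {t} → t ≢ s → branch t ≡ 0 → ¬ Below s t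
    branch≡0⇒¬below {t} t≢s eq (s≤t , e) with ℕₚ.m≤n⇒m<n∨m≡n s≤t
    ... | inj₂ s≡t = t≢s (trans (cong (λ j → up j t)
                       (sym (trans (cong (depth t ∸_) s≡t) (ℕₚ.n∸n≡0 (depth t))))) e)
    ... | inj₁ s<t with trans (sym eq) (branch-yes (s<t , trans (sym (up-suc (depth t ∸ suc (depth s)) t))
                          (trans (cong (λ j → up j t) (sym (ℕₚ.+-∸-assoc 1 s<t))) e)))
    ...   | ()

    -- That `c` is strictly deeper than `s` is what later plays against the choice of `s` as a
    -- deepest heavy node.
    branch≡suc⇒below : ∀ {t l} → branch t ≡ suc l →
      ∃[ c ] toℕ c ≡ l × Below c t × depth s < depth c
    branch≡suc⇒below {t} eq with inBranch? t
    branch≡suc⇒below {t} refl | yes (s<t , _) =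
      branchTop t , refl , (subst (_≤ depth t) (sym dc) s<t , cong (λ d → up (depth t ∸ d) t) dc)
      , ℕₚ.≤-reflexive (sym dc)
      where
      dc : depth (branchTop t) ≡ suc (depth s)
      dc = depth-up _ (sym (ℕₚ.m∸n+n≡m s<t))

greatestElement : ∀ {m} (f : Fin m → ℕ) {P : Pred (Fin m) 0ℓ} → Decidable P → ∃ P →
                  ∃[ i ] P i × (∀ j → P j → f j ≤ f i)
greatestElement {suc m} f {P} P? (i , pi) with any? (λ j → P? (suc j))
... | no none = zero , head i pi , λ
  { zero _ → ℕₚ.≤-refl ; (suc j) pj → contradiction (j , pj) none }
  where
  head : ∀ i → P i → P zero
  head zero    pi = pi
  head (suc i) pi = contradiction (i , pi) none
... | yes some with greatestElement (f ∘ suc) (λ j → P? (suc j)) some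
...   | j , pj , max with P? zero
...     | no ¬p0 = suc j , pj , λ { zero p0 → contradiction p0 ¬p0 ; (suc k) → max k }
...     | yes p0 with ℕₚ.≤-total (f zero) (f (suc j))
...       | inj₁ le = suc j , pj , λ { zero _ → le ; (suc k) → max k }
...       | inj₂ ge = zero , p0 , λ
  { zero _ → ℕₚ.≤-refl ; (suc k) pk → ℕₚ.≤-trans (max k pk) ge }

-- A labelling of the vertices outside S that is constant on the components of G - S.
record Pieces {n} (G : Graph n) (S : Subset n) : Set where
  field
    label    : Fin n → ℕ
    constant : ∀ {u v} → u ∉ S → v ∉ S → Adj G u v → label u ≡ label v

  InPiece : ℕ → Fin n → Set
  InPiece c v = v ∉ S × label v ≡ c

  inPiece? : ∀ c → Decidable (InPiece c)
  inPiece? c v = ¬? (v ∈? S) ×-dec (label v ℕₚ.≟ c)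

  piece : ℕ → Subset n
  piece c = select (inPiece? c)

  AtMostHalf : Set
  AtMostHalf = ∀ c → 2 * ∣ piece c ∣ ≤ n

-- The bag is that of a deepest node whose subtree carries at least half of the vertices.
module _ {n} {G : Graph n} (D : TreeDecomposition G) where
  open TreeDecomposition D hiding (m; bag; Node)
  open Rooted tree isTree

  private
    -- Each vertex is counted at one chosen node, so that disjoint subtrees have disjoint loads.
    home : Fin n → Node D
    home v = proj₁ (vertices v)

    load : Node D → Subset n
    load c = select λ v → below? c (home v)

    Heavy : Node D → Set
    Heavy c = n ≤ 2 * ∣ load c ∣

    root-heavy : Heavy root
    root-heavy = ℕₚ.≤-trans (ℕₚ.≤-trans (ℕₚ.≤-reflexive (sym (∣⊤∣≡n n)))
      (p⊆q⇒∣p∣≤∣q∣ {p = ⊤} λ {v} _ → ∈-select⁺ (λ v → below? root (home v)) (below-root (home v))))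
      (ℕₚ.m≤m+n _ _)

  balancedBag : Σ (Node D) λ s → Σ (Pieces G (bag D s)) Pieces.AtMostHalf
  balancedBag with greatestElement depth (λ c → n ℕₚ.≤? 2 * ∣ load c ∣) (root , root-heavy)
  ... | s , heavy , deepest = s , pieces , half
    where
    open Branches s
    -- A walk through bags that contain `v` cannot visit `s`, so it stays in one component of the
    -- tree minus `s`.
    same-branch : ∀ {v} → v ∉ bag D s → ∀ {t t′} →
      Star (λ a b → v ∈ bag D a × v ∈ bag D b × Adj tree a b) t t′ → branch t ≡ branch t′
    same-branch v∉ ε = refl
    same-branch v∉ ((v∈a , v∈b , ab) ◅ walk) = trans
      (branch-adj (λ { refl → v∉ v∈a }) (λ { refl → v∉ v∈b }) ab) (same-branch v∉ walk)

    branch-home : ∀ {v t} → v ∉ bag D s → v ∈ bag D t → branch (home v) ≡ branch t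
    branch-home {v} v∉ v∈ = same-branch v∉ (subtree v (proj₂ (vertices v)) v∈)

    pieces : Pieces G (bag D s)
    pieces .Pieces.label    v = branch (home v)
    pieces .Pieces.constant {u} {v} u∉ v∉ uv with edges u v uv
    ... | t , u∈ , v∈ = trans (branch-home u∉ u∈) (sym (branch-home v∉ v∈))

    open Pieces pieces
    half : AtMostHalf
    -- The vertices of piece 0 have their home outside the subtree at `s`, and that subtree carries
    -- at least n/2.
    half zero = ℕₚ.+-cancelʳ-≤ (2 * ∣ load s ∣) _ _ (begin
      2 * ∣ piece 0 ∣ + 2 * ∣ load s ∣   ≡⟨ ℕₚ.*-distribˡ-+ 2 ∣ piece 0 ∣ _ ⟨
      2 * (∣ piece 0 ∣ + ∣ load s ∣)     ≤⟨ ℕₚ.*-monoʳ-≤ 2 disjoint ⟩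
      2 * n                             ≡⟨ cong (n +_) (ℕₚ.+-identityʳ n) ⟩
      n + n                             ≤⟨ ℕₚ.+-monoʳ-≤ n heavy ⟩
      n + 2 * ∣ load s ∣                 ∎)
      where
      open ℕₚ.≤-Reasoning
      disjoint : ∣ piece 0 ∣ + ∣ load s ∣ ≤ n
      disjoint = subst (∣ piece 0 ∣ + ∣ load s ∣ ≤_) (∣⊤∣≡n n) (∣q∣+∣r∣≤∣p∣ {p = ⊤} ⊆⊤ ⊆⊤ λ {v} v∈piece v∈load →
        let v∉ , eq = ∈-select⁻ (inPiece? 0) v∈piece in
        branch≡0⇒¬below (λ { refl → v∉ (proj₂ (vertices v)) }) eq
          (∈-select⁻ (λ v → below? s (home v)) v∈load))
    -- A positive label names a node `c` deeper than `s` whose subtree carries the whole piece; by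
    -- the choice of `s` it is not heavy. Without such a `c` the piece is empty.
    half (suc l) with any? (λ c → (toℕ c ℕₚ.≟ l) ×-dec (depth s ℕₚ.<? depth c))
    ... | yes (c , refl , s<c) = ℕₚ.≤-trans (ℕₚ.*-monoʳ-≤ 2 (p⊆q⇒∣p∣≤∣q∣ piece⊆load))
                                  (ℕₚ.<⇒≤ (ℕₚ.≰⇒> λ h → ℕₚ.<⇒≱ s<c (deepest c h)))
      where
      piece⊆load : piece (suc (toℕ c)) ⊆ load c
      piece⊆load {v} v∈ with branch≡suc⇒below (proj₂ (∈-select⁻ (inPiece? (suc (toℕ c))) v∈))
      ... | c′ , eq , b , _ = ∈-select⁺ (λ v → below? c (home v))
                                (subst (λ c → Below c (home v)) (toℕ-injective eq) b)
    ... | no none = ℕₚ.≤-trans (ℕₚ.*-monoʳ-≤ 2 (p⊆q⇒∣p∣≤∣q∣ {q = ⊥} λ v∈ →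
        let c , eq , _ , lt = branch≡suc⇒below (proj₂ (∈-select⁻ (inPiece? (suc l)) v∈)) in
        contradiction (c , eq , lt) none))
      (subst (λ k → 2 * k ≤ n) (sym (∣⊥∣≡0 n)) z≤n)

-- Balanced separations and slabs of layers

-- The pieces are split at the least label k at which those below k contain more than n/4 vertices.
module _ {n} {G : Graph n} {S : Subset n} (𝒫 : Pieces G S) where
  open Pieces 𝒫

  private
    low? : ∀ k → Decidable (λ v → v ∉ S × label v < k)
    low? k v = ¬? (v ∈? S) ×-dec (label v ℕₚ.<? k)

    high? : ∀ k → Decidable (λ v → v ∉ S × k ≤ label v)
    high? k v = ¬? (v ∈? S) ×-dec (k ℕₚ.≤? label v)

    low high : ℕ → Subset n
    low  = select ∘ low?
    high = select ∘ high?

    low+high : ∀ k → ∣ low k ∣ + ∣ high k ∣ ≤ n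
    low+high k = subst (∣ low k ∣ + ∣ high k ∣ ≤_) (∣⊤∣≡n n) (∣q∣+∣r∣≤∣p∣ {p = ⊤} ⊆⊤ ⊆⊤ λ x∈ x∈′ →
      ℕₚ.<⇒≱ (proj₂ (∈-select⁻ (low? k) x∈)) (proj₂ (∈-select⁻ (high? k) x∈′)))

    low-suc : ∀ k → ∣ low (suc k) ∣ ≤ ∣ low k ∣ + ∣ piece k ∣
    low-suc k = ∣p∣≤∣q∣+∣r∣ split
      where
      split : ∀ {x} → x ∈ low (suc k) → x ∈ low k ⊎ x ∈ piece k
      split x∈ with ∈-select⁻ (low? (suc k)) x∈
      ... | x∉S , lt with ℕₚ.m≤n⇒m<n∨m≡n (ℕ.s≤s⁻¹ lt)
      ...   | inj₁ lt = inj₁ (∈-select⁺ (low? k) (x∉S , lt))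
      ...   | inj₂ eq = inj₂ (∈-select⁺ (inPiece? k) (x∉S , eq))

    threshold : AtMostHalf → ∃[ k ] 4 * ∣ low k ∣ ≤ 3 * n × 4 * ∣ high k ∣ ≤ 3 * n
    threshold half with crossing (λ k → 4 * ∣ low k ∣ ℕₚ.≤? n) low0 (proj₁ (bounded label))
      where
      low0 : 4 * ∣ low 0 ∣ ≤ n
      low0 = subst (λ k → 4 * k ≤ n) (sym (trans (cong ∣_∣ (Empty-unique {p = low 0} λ (_ , x∈) →
        ℕₚ.n≮0 (proj₂ (∈-select⁻ (low? 0) x∈)))) (∣⊥∣≡0 n))) z≤n
    ... | inj₁ few = K , ℕₚ.≤-trans few (ℕₚ.m≤n*m n 3) ,
        subst (λ k → 4 * k ≤ 3 * n) (sym (trans (cong ∣_∣ (Empty-unique {p = high K} λ (x , x∈) →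
        ℕₚ.<⇒≱ (proj₂ (bounded label) x) (proj₂ (∈-select⁻ (high? K) x∈)))) (∣⊥∣≡0 n))) z≤n
      where K = proj₁ (bounded label)
    -- Origin of 3/4: up to the crossing there are at most n/4 vertices, and one more piece adds at
    -- most n/2. Beyond it more than n/4 lie on the low side, which leaves less than 3n/4 for the
    -- high side.
    ... | inj₂ (k , few , many) = suc k ,
        (begin
          4 * ∣ low (suc k) ∣               ≤⟨ ℕₚ.*-monoʳ-≤ 4 (low-suc k) ⟩
          4 * (∣ low k ∣ + ∣ piece k ∣)      ≡⟨ lemma ∣ low k ∣ ∣ piece k ∣ ⟩
          4 * ∣ low k ∣ + 2 * (2 * ∣ piece k ∣) ≤⟨ ℕₚ.+-mono-≤ few (ℕₚ.*-monoʳ-≤ 2 (half k)) ⟩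
          n + 2 * n                        ∎) ,
        ℕₚ.+-cancelˡ-≤ n _ _ (begin
          n + 4 * ∣ high (suc k) ∣          ≤⟨ ℕₚ.+-monoˡ-≤ _ (ℕₚ.<⇒≤ (ℕₚ.≰⇒> many)) ⟩
          4 * ∣ low (suc k) ∣ + 4 * ∣ high (suc k) ∣ ≡⟨ ℕₚ.*-distribˡ-+ 4 ∣ low (suc k) ∣ _ ⟨
          4 * (∣ low (suc k) ∣ + ∣ high (suc k) ∣)   ≤⟨ ℕₚ.*-monoʳ-≤ 4 (low+high (suc k)) ⟩
          4 * n                            ∎)
      where
      open ℕₚ.≤-Reasoning
      lemma : ∀ a b → 4 * (a + b) ≡ 4 * a + 2 * (2 * b)
      lemma = solve-∀

  abstract
    balancedSeparation : AtMostHalf → Σ (Separation G) λ s → let open Separation s in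
      A ∩ B ≡ S × 4 * ∣ A ─ B ∣ ≤ 3 * n × 4 * ∣ B ─ A ∣ ≤ 3 * n
    balancedSeparation half with threshold half
    ... | k , few-low , few-high = separation , ⊆-antisym A∩B⊆S S⊆A∩B ,
        ℕₚ.≤-trans (ℕₚ.*-monoʳ-≤ 4 (p⊆q⇒∣p∣≤∣q∣ (∈-select⁺ (low? k) ∘ A─B⇒low))) few-low ,
        ℕₚ.≤-trans (ℕₚ.*-monoʳ-≤ 4 (p⊆q⇒∣p∣≤∣q∣ (∈-select⁺ (high? k) ∘ B─A⇒high))) few-high
      where
      A? : Decidable (λ v → v ∈ S ⊎ label v < k)
      A? v = (v ∈? S) ⊎-dec (label v ℕₚ.<? k)
      B? : Decidable (λ v → v ∈ S ⊎ k ≤ label v)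
      B? v = (v ∈? S) ⊎-dec (k ℕₚ.≤? label v)
      A B : Subset n
      A = select A?
      B = select B?

      A─B⇒low : ∀ {v} → v ∈ A ─ B → v ∉ S × label v < k
      A─B⇒low v∈ with x∈p─q⁻ A B v∈
      ... | _ , v∉B = (λ v∈S → v∉B (∈-select⁺ B? (inj₁ v∈S))) ,
                        ℕₚ.≰⇒> (λ le → v∉B (∈-select⁺ B? (inj₂ le)))
      B─A⇒high : ∀ {v} → v ∈ B ─ A → v ∉ S × k ≤ label v
      B─A⇒high v∈ with x∈p─q⁻ B A v∈
      ... | _ , v∉A = (λ v∈S → v∉A (∈-select⁺ A? (inj₁ v∈S))) ,
                        ℕₚ.≮⇒≥ (λ lt → v∉A (∈-select⁺ A? (inj₂ lt)))

      separation : Separation G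
      separation .Separation.A = A
      separation .Separation.B = B
      separation .Separation.covers = ⊆-antisym ⊆⊤ λ {v} _ → x∈p∪q⁺ (either v)
        where
        either : ∀ v → v ∈ A ⊎ v ∈ B
        either v with label v ℕₚ.<? k
        ... | yes lt = inj₁ (∈-select⁺ A? (inj₂ lt))
        ... | no ¬lt = inj₂ (∈-select⁺ B? (inj₂ (ℕₚ.≮⇒≥ ¬lt)))
      separation .Separation.noEdge u v u∈ v∈ uv with A─B⇒low u∈ | B─A⇒high v∈
      ... | u∉ , lt | v∉ , le = ℕₚ.<⇒≱ (subst (_< k) (constant u∉ v∉ uv) lt) le

      S⊆A∩B : S ⊆ A ∩ B
      S⊆A∩B v∈ = x∈p∩q⁺ (∈-select⁺ A? (inj₁ v∈) , ∈-select⁺ B? (inj₁ v∈))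
      A∩B⊆S : A ∩ B ⊆ S
      A∩B⊆S v∈ with x∈p∩q⁻ A B v∈
      ... | v∈A , v∈B with ∈-select⁻ A? v∈A | ∈-select⁻ B? v∈B
      ...   | inj₁ v∈S | _        = v∈S
      ...   | inj₂ _   | inj₁ v∈S = v∈S
      ...   | inj₂ lt  | inj₂ le  = contradiction le (ℕₚ.<⇒≱ lt)

module _ {n} (g : Fin n → ℕ) where
  residueClass : ∀ p .{{_ : NonZero p}} → ℕ → Subset n
  residueClass p r = select λ v → g v % p ℕₚ.≟ r

  -- Averaging, done by induction: the sparsest of the first `suc k` classes, counted `suc k` times,
  -- fits into the union of these classes.
  sparse-residue : ∀ p .{{_ : NonZero p}} → ∃[ r ] r < p × p * ∣ residueClass p r ∣ ≤ n
  sparse-residue p@(suc p-1) with go p-1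
    where
    below : ℕ → Subset n
    below k = select λ v → g v % p ℕₚ.<? k
    split : ∀ k → ∣ residueClass p k ∣ + ∣ below k ∣ ≤ ∣ below (suc k) ∣
    split k = ∣q∣+∣r∣≤∣p∣
      (λ {x} x∈ → ∈-select⁺ (λ v → g v % p ℕₚ.<? suc k)
                    (s≤s (ℕₚ.≤-reflexive (∈-select⁻ (λ v → g v % p ℕₚ.≟ k) {x} x∈))))
      (λ {x} x∈ → ∈-select⁺ (λ v → g v % p ℕₚ.<? suc k)
                    (ℕₚ.m≤n⇒m≤1+n (∈-select⁻ (λ v → g v % p ℕₚ.<? k) {x} x∈)))
      (λ {x} x∈ x∈′ → ℕₚ.<-irrefl (∈-select⁻ (λ v → g v % p ℕₚ.≟ k) {x} x∈)
                        (∈-select⁻ (λ v → g v % p ℕₚ.<? k) {x} x∈′))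
    go : ∀ k → ∃[ r ] r ≤ k × suc k * ∣ residueClass p r ∣ ≤ ∣ below (suc k) ∣
    go zero = 0 , z≤n , ℕₚ.≤-trans (ℕₚ.+-monoʳ-≤ ∣ residueClass p 0 ∣ z≤n) (split 0)
    go (suc k) with go k
    ... | r , r≤k , le with ℕₚ.≤-total ∣ residueClass p r ∣ ∣ residueClass p (suc k) ∣
    ...   | inj₁ r-sparser = r , ℕₚ.m≤n⇒m≤1+n r≤k ,
              ℕₚ.≤-trans (ℕₚ.+-mono-≤ r-sparser le) (split (suc k))
    ...   | inj₂ k-sparser = suc k , ℕₚ.≤-refl , ℕₚ.≤-trans
              (ℕₚ.+-monoʳ-≤ _ (ℕₚ.≤-trans (ℕₚ.*-monoʳ-≤ (suc k) k-sparser) le)) (split (suc k))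
  ... | r , r≤p , le = r , s≤s r≤p , ℕₚ.≤-trans le (∣p∣≤n (select λ v → g v % p ℕₚ.<? p))

  -- `q` is the value at which the count of vertices up to and including it first exceeds n/2. With
  -- slab numbers for `g`, only slab `q` can still hold a component that is too large.
  median : ∃[ q ] 2 * ∣ select (λ v → g v ℕₚ.<? q) ∣ ≤ n × 2 * ∣ select (λ v → q ℕₚ.<? g v) ∣ ≤ n
  median with crossing (λ k → 2 * ∣ before k ∣ ℕₚ.≤? n) before0 (proj₁ (bounded g))
    where
    before : ℕ → Subset n
    before k = select λ v → g v ℕₚ.<? k
    before0 : 2 * ∣ before 0 ∣ ≤ n
    before0 = subst (λ k → 2 * k ≤ n) (sym (trans (cong ∣_∣ (Empty-unique {p = before 0} λ (x , x∈) →
        ℕₚ.n≮0 (∈-select⁻ (λ v → g v ℕₚ.<? 0) x∈))) (∣⊥∣≡0 n))) z≤n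
  ... | inj₁ few = K , few , subst (λ k → 2 * k ≤ n)
      (sym (trans (cong ∣_∣ (Empty-unique {p = select (λ v → K ℕₚ.<? g v)} λ (x , x∈) →
        ℕₚ.<-asym (proj₂ (bounded g) x) (∈-select⁻ (λ v → K ℕₚ.<? g v) x∈))) (∣⊥∣≡0 n))) z≤n
    where K = proj₁ (bounded g)
  ... | inj₂ (q , few , many) = q , few , ℕₚ.+-cancelˡ-≤ n _ _ (begin
      n + 2 * ∣ after ∣                   ≤⟨ ℕₚ.+-monoˡ-≤ _ (ℕₚ.<⇒≤ (ℕₚ.≰⇒> many)) ⟩
      2 * ∣ upto ∣ + 2 * ∣ after ∣        ≡⟨ ℕₚ.*-distribˡ-+ 2 ∣ upto ∣ _ ⟨
      2 * (∣ upto ∣ + ∣ after ∣)          ≤⟨ ℕₚ.*-monoʳ-≤ 2 (subst (∣ upto ∣ + ∣ after ∣ ≤_) (∣⊤∣≡n n)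
        (∣q∣+∣r∣≤∣p∣ {p = ⊤} ⊆⊤ ⊆⊤ λ x∈ x∈′ →
          ℕₚ.<⇒≱ (∈-select⁻ (λ v → g v ℕₚ.<? suc q) x∈) (∈-select⁻ (λ v → q ℕₚ.<? g v) x∈′))) ⟩
      2 * n                              ≡⟨ cong (n +_) (ℕₚ.+-identityʳ n) ⟩
      n + n                              ∎)
    where
    open ℕₚ.≤-Reasoning
    upto after : Subset n
    upto  = select λ v → g v ℕₚ.<? suc q
    after = select λ v → q ℕₚ.<? g v

-- Going up one layer changes the slab only on entering a multiple of `p`, and those layers are
-- deleted.
suc-/ : ∀ m p .{{_ : NonZero p}} → suc m % p ≢ 0 → suc m / p ≡ m / p
suc-/ m p ¬0 = ℕₚ.≤-antisym lower (/-monoˡ-≤ p (ℕₚ.n≤1+n m))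
  where
  q*p≤m : suc m / p * p ≤ m
  q*p≤m with ℕₚ.m≤n⇒m<n∨m≡n (m/n*n≤m (suc m) p)
  ... | inj₁ lt = ℕ.s≤s⁻¹ lt
  ... | inj₂ eq = contradiction (trans (cong (_% p) (sym eq)) (m*n%n≡0 (suc m / p) p)) ¬0
  lower : suc m / p ≤ m / p
  lower = subst (_≤ m / p) (m*n/n≡m (suc m / p) p) (/-monoˡ-≤ p q*p≤m)

-- Adding `p ∸ r` to the layer index turns the deleted class `r` into the multiples of `p`, so that
-- the slabs become the fibres of division by `p`.
shift-residue : ∀ i {r p} .{{_ : NonZero p}} → r < p → (i + (p ∸ r)) % p ≡ 0 → i % p ≡ r
shift-residue i {r} {p} r<p eq = begin
  i % p                ≡⟨ cong (_% p) i≡ ⟩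
  (r + (q ∸ 1) * p) % p ≡⟨ [m+kn]%n≡m%n r (q ∸ 1) p ⟩
  r % p                ≡⟨ m<n⇒m%n≡m r<p ⟩
  r                    ∎
  where
  open ≡-Reasoning
  q = (i + (p ∸ r)) / p
  i+p∸r : i + (p ∸ r) ≡ q * p
  i+p∸r = trans (m≡m%n+[m/n]*n _ p) (cong (_+ q * p) eq)
  pred-q : ∀ q → i + (p ∸ r) ≡ q * p → q * p ≡ p + (q ∸ 1) * p
  pred-q zero    e = contradiction (ℕₚ.m+n≡0⇒n≡0 i e) (ℕₚ.m>n⇒m∸n≢0 r<p)
  pred-q (suc q) e = refl
  i≡ : i ≡ r + (q ∸ 1) * p
  i≡ = ℕₚ.+-cancelʳ-≡ (p ∸ r) _ _ (begin
    i + (p ∸ r)               ≡⟨ i+p∸r ⟩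
    q * p                     ≡⟨ pred-q q i+p∸r ⟩
    p + (q ∸ 1) * p           ≡⟨ cong (_+ (q ∸ 1) * p) (ℕₚ.m+[n∸m]≡n (ℕₚ.<⇒≤ r<p)) ⟨
    r + (p ∸ r) + (q ∸ 1) * p ≡⟨ ℕₚ.+-assoc r (p ∸ r) _ ⟩
    r + (p ∸ r + (q ∸ 1) * p) ≡⟨ cong (r +_) (ℕₚ.+-comm (p ∸ r) _) ⟩
    r + ((q ∸ 1) * p + (p ∸ r)) ≡⟨ ℕₚ.+-assoc r _ _ ⟨
    r + (q ∸ 1) * p + (p ∸ r) ∎)

∣a-b∣≤1⁻ : ∀ a b → ∣ a - b ∣ ≤ 1 → a ≡ b ⊎ suc a ≡ b ⊎ a ≡ suc b
∣a-b∣≤1⁻ zero          zero          _  = inj₁ refl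
∣a-b∣≤1⁻ zero          (suc zero)    _  = inj₂ (inj₁ refl)
∣a-b∣≤1⁻ zero          (suc (suc b)) (s≤s ())
∣a-b∣≤1⁻ (suc zero)    zero          _  = inj₂ (inj₂ refl)
∣a-b∣≤1⁻ (suc (suc a)) zero          (s≤s ())
∣a-b∣≤1⁻ (suc a)       (suc b)       le with ∣a-b∣≤1⁻ a b le
... | inj₁ e        = inj₁ (cong suc e)
... | inj₂ (inj₁ e) = inj₂ (inj₁ (cong suc e))
... | inj₂ (inj₂ e) = inj₂ (inj₂ (cong suc e))

α-bounded : ∀ {n} (G : Graph n) S {I k} → α G S ≤ k → I ⊆ S → Independent G I → ∣ I ∣ ≤ k
α-bounded G S α≤k I⊆S ind = ℕₚ.≤-trans (α-maximal G S I⊆S ind) α≤k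

-- Removing every p-th layer leaves slabs of fewer than p layers.  In the median slab
-- we also remove the balanced bag.
module _ {n} {G : Graph n} (D : TreeDecomposition G) (L : Layering G) (p : ℕ) .{{_ : NonZero p}} where
  open Layering L using (index; adjacent)

  abstract
    layered-separator : Σ (Subset n) λ R → Σ (Subset n) λ Y →
      p * ∣ R ∣ ≤ n × Σ (Pieces G (R ∪ Y)) Pieces.AtMostHalf ×
      (∀ {ℓ} → (∀ t i → α G (bag D t ∩ layer L i) ≤ ℓ) →
        ∀ {I} → I ⊆ Y → Independent G I → ∣ I ∣ ≤ p * ℓ)
    layered-separator with sparse-residue index p
    ... | r , r<p , sparse with median (λ v → (index v + (p ∸ r)) / p) | balancedBag D
    ...   | q , few-before , few-after | t , 𝒬 , half = R , Y , R-small , (pieces , pieces-half) , Y-bounded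
      where
      shifted slab : Fin n → ℕ
      shifted v = index v + (p ∸ r)
      slab v = shifted v / p
      R? : Decidable (λ v → shifted v % p ≡ 0)
      R? v = shifted v % p ℕₚ.≟ 0
      Y? : Decidable (λ v → v ∈ bag D t × slab v ≡ q)
      Y? v = (v ∈? bag D t) ×-dec (slab v ℕₚ.≟ q)
      R Y : Subset n
      R = select R?
      Y = select Y?

      R-small : p * ∣ R ∣ ≤ n
      R-small = ℕₚ.≤-trans (ℕₚ.*-monoʳ-≤ p (p⊆q⇒∣p∣≤∣q∣ λ {v} v∈ →
        ∈-select⁺ (λ v → index v % p ℕₚ.≟ r) (shift-residue (index v) r<p (∈-select⁻ R? v∈)))) sparse

      ∉R : ∀ {v} → v ∉ R ∪ Y → shifted v % p ≢ 0
      ∉R v∉ eq = v∉ (x∈p∪q⁺ (inj₁ (∈-select⁺ R? eq)))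

      ∉bag : ∀ {v} → v ∉ R ∪ Y → slab v ≡ q → v ∉ bag D t
      ∉bag v∉ eq v∈ = v∉ (x∈p∪q⁺ {p = R} (inj₂ (∈-select⁺ Y? (v∈ , eq))))

      slab-constant : ∀ {u v} → u ∉ R ∪ Y → v ∉ R ∪ Y → Adj G u v → slab u ≡ slab v
      slab-constant {u} {v} u∉ v∉ uv with ∣a-b∣≤1⁻ (index u) (index v) (adjacent u v uv)
      ... | inj₁ e        = cong (λ i → (i + (p ∸ r)) / p) e
      ... | inj₂ (inj₁ e) = sym (trans (cong (λ i → (i + (p ∸ r)) / p) (sym e))
        (suc-/ (shifted u) p (∉R v∉ ∘ trans (cong (λ i → (i + (p ∸ r)) % p) (sym e)))))
      ... | inj₂ (inj₂ e) = trans (cong (λ i → (i + (p ∸ r)) / p) e)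
        (suc-/ (shifted v) p (∉R u∉ ∘ trans (cong (λ i → (i + (p ∸ r)) % p) e)))

      -- Labels 0 and 1 gather everything before and after the median slab; shifting by 2 keeps the
      -- pieces left by the bag apart from these.
      lab : ℕ → ℕ → ℕ
      lab x c with ℕₚ.<-cmp x q
      ... | tri< _ _ _ = 0
      ... | tri≈ _ _ _ = suc (suc c)
      ... | tri> _ _ _ = 1

      lab-cong : ∀ {x y c d} → x ≡ y → (x ≡ q → c ≡ d) → lab x c ≡ lab y d
      lab-cong {x} refl c≡d with ℕₚ.<-cmp x q
      ... | tri< _ _ _ = refl
      ... | tri≈ _ e _ = cong (λ c → suc (suc c)) (c≡d e)
      ... | tri> _ _ _ = refl

      pieces : Pieces G (R ∪ Y)
      pieces .Pieces.label v = lab (slab v) (Pieces.label 𝒬 v)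
      pieces .Pieces.constant {u} {v} u∉ v∉ uv = lab-cong same λ eq →
        Pieces.constant 𝒬 (∉bag u∉ eq) (∉bag v∉ (trans (sym same) eq)) uv
        where
        same : slab u ≡ slab v
        same = slab-constant u∉ v∉ uv

      open Pieces pieces
      lab⁻ : ∀ {x c} d → lab x c ≡ d → (d ≡ 0 × x < q) ⊎ (d ≡ 1 × q < x) ⊎ (x ≡ q × d ≡ suc (suc c))
      lab⁻ {x} d eq with ℕₚ.<-cmp x q
      ... | tri< lt _ _ = inj₁ (sym eq , lt)
      ... | tri≈ _ e _  = inj₂ (inj₂ (e , sym eq))
      ... | tri> _ _ gt = inj₂ (inj₁ (sym eq , gt))

      pieces-half : AtMostHalf
      pieces-half 0 = ℕₚ.≤-trans (ℕₚ.*-monoʳ-≤ 2 (p⊆q⇒∣p∣≤∣q∣ sub)) few-before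
        where
        sub : piece 0 ⊆ select (λ v → slab v ℕₚ.<? q)
        sub v∈ with lab⁻ 0 (proj₂ (∈-select⁻ (inPiece? 0) v∈))
        ... | inj₁ (_ , lt) = ∈-select⁺ (λ v → slab v ℕₚ.<? q) lt
        ... | inj₂ (inj₁ (() , _))
        ... | inj₂ (inj₂ (_ , ()))
      pieces-half 1 = ℕₚ.≤-trans (ℕₚ.*-monoʳ-≤ 2 (p⊆q⇒∣p∣≤∣q∣ sub)) few-after
        where
        sub : piece 1 ⊆ select (λ v → q ℕₚ.<? slab v)
        sub v∈ with lab⁻ 1 (proj₂ (∈-select⁻ (inPiece? 1) v∈))
        ... | inj₁ (() , _)
        ... | inj₂ (inj₁ (_ , gt)) = ∈-select⁺ (λ v → q ℕₚ.<? slab v) gt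
        ... | inj₂ (inj₂ (_ , ()))
      pieces-half (suc (suc c)) = ℕₚ.≤-trans (ℕₚ.*-monoʳ-≤ 2 (p⊆q⇒∣p∣≤∣q∣ sub)) (half c)
        where
        sub : piece (suc (suc c)) ⊆ Pieces.piece 𝒬 c
        sub v∈ with ∈-select⁻ (inPiece? (suc (suc c))) v∈
        ... | v∉ , eq with lab⁻ (suc (suc c)) eq
        ...   | inj₁ (() , _)
        ...   | inj₂ (inj₁ (() , _))
        ...   | inj₂ (inj₂ (e , refl)) = ∈-select⁺ (Pieces.inPiece? 𝒬 c) (∉bag v∉ e , refl)

      Y-bounded : ∀ {ℓ} → (∀ t i → α G (bag D t ∩ layer L i) ≤ ℓ) →
                  ∀ {I} → I ⊆ Y → Independent G I → ∣ I ∣ ≤ p * ℓ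
      Y-bounded {ℓ} α≤ {I} I⊆Y ind =
        subst (λ k → ∣ I ∣ ≤ k * ℓ) (∣⊤∣≡n p) (cover-bound I (⊤ {p}) F cover small)
        where
        F? : ∀ j → Decidable (λ v → v ∈ I × shifted v ≡ toℕ {p} j + q * p)
        F? j v = (v ∈? I) ×-dec (shifted v ℕₚ.≟ toℕ j + q * p)
        -- Inside slab `q` the residue `j` determines the layer, so `I` splits into `p` parts, each
        -- within one bag and one layer.
        F : Fin p → Subset n
        F j = select (F? j)
        cover : ∀ {v} → v ∈ I → ∃[ j ] j ∈ ⊤ {p} × v ∈ F j
        cover {v} v∈ = fromℕ< (m%n<n (shifted v) p) , ∈⊤ , ∈-select⁺ (F? _) (v∈ ,
          trans (m≡m%n+[m/n]*n (shifted v) p)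
            (cong₂ (λ a b → a + b * p) (sym (toℕ-fromℕ< (m%n<n (shifted v) p)))
              (proj₂ (∈-select⁻ Y? (I⊆Y v∈)))))
        small : ∀ j → ∣ F j ∣ ≤ ℓ
        small j with nonempty? (F j)
        ... | no empty = subst (_≤ ℓ) (sym (trans (cong ∣_∣ (Empty-unique empty)) (∣⊥∣≡0 n))) z≤n
        -- The layer is read off an element, since `toℕ j + q * p` may be smaller than the shift
        -- `p ∸ r` and then corresponds to no layer.
        ... | yes (v , v∈) = α-bounded G (bag D t ∩ layer L (index v)) (α≤ t (index v))
          (λ {w} w∈ → x∈p∩q⁺ (proj₁ (∈-select⁻ Y? (I⊆Y (proj₁ (∈-select⁻ (F? j) w∈)))) ,
            ∈-select⁺ (λ w → index w ℕₚ.≟ index v) (ℕₚ.+-cancelʳ-≡ (p ∸ r) (index w) (index v)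
              (trans (proj₂ (∈-select⁻ (F? j) w∈)) (sym (proj₂ (∈-select⁻ (F? j) v∈)))))))
          λ u w u∈ w∈ → ind u w (proj₁ (∈-select⁻ (F? j) u∈)) (proj₁ (∈-select⁻ (F? j) w∈))

-- Clique partitions by Ramsey's theorem

-- An upper bound for the Ramsey numbers, from the usual argument: apart from a chosen vertex there
-- are enough neighbours for a clique on `s` more vertices or enough non-neighbours for an
-- independent set on `k` more.
ramsey : ℕ → ℕ → ℕ
ramsey zero    _       = 0
ramsey (suc s) zero    = 0
ramsey (suc s) (suc k) = suc (ramsey s (suc k) + ramsey (suc s) k)

∣p∪⁅x⁆∣≡1+∣p∣ : ∀ {n} (p : Subset n) {x} → x ∉ p → ∣ p ∪ ⁅ x ⁆ ∣ ≡ suc ∣ p ∣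
∣p∪⁅x⁆∣≡1+∣p∣ p {x} x∉p = ℕₚ.≤-antisym
  (ℕₚ.≤-trans (∣p∪q∣≤∣p∣+∣q∣ p ⁅ x ⁆) (ℕₚ.≤-reflexive ∣p∣+1))
  (ℕₚ.≤-trans (ℕₚ.≤-reflexive (sym ∣p∣+1)) (∣p∣+∣q∣≤∣p∪q∣ p ⁅ x ⁆ λ (y , y∈) →
    let y∈p , y∈x = x∈p∩q⁻ p ⁅ x ⁆ y∈ in x∉p (subst (_∈ p) (x∈⁅y⁆⇒x≡y x y∈x) y∈p)))
  where
  ∣p∣+1 : ∣ p ∣ + ∣ ⁅ x ⁆ ∣ ≡ suc ∣ p ∣
  ∣p∣+1 = trans (cong (∣ p ∣ +_) (∣⁅x⁆∣≡1 x)) (ℕₚ.+-comm ∣ p ∣ 1)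

p─⁅x⁆∪⁅x⁆ : ∀ {n} (p : Subset n) {x} → x ∈ p → (p ─ ⁅ x ⁆) ∪ ⁅ x ⁆ ≡ p
p─⁅x⁆∪⁅x⁆ p {x} x∈p = ⊆-antisym fwd bwd
  where
  fwd : (p ─ ⁅ x ⁆) ∪ ⁅ x ⁆ ⊆ p
  fwd y∈ with x∈p∪q⁻ (p ─ ⁅ x ⁆) ⁅ x ⁆ y∈
  ... | inj₁ y∈p = p─q⊆p p ⁅ x ⁆ y∈p
  ... | inj₂ y∈x = subst (_∈ p) (sym (x∈⁅y⁆⇒x≡y x y∈x)) x∈p
  bwd : p ⊆ (p ─ ⁅ x ⁆) ∪ ⁅ x ⁆
  bwd {y} y∈ with y ∈? ⁅ x ⁆
  ... | yes y∈x = x∈p∪q⁺ {p = p ─ ⁅ x ⁆} (inj₂ y∈x)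
  ... | no  y∉x = x∈p∪q⁺ (inj₁ (x∈p∧x∉q⇒x∈p─q y∈ y∉x))

∣p─⁅x⁆∣ : ∀ {n} (p : Subset n) {x} → x ∈ p → suc ∣ p ─ ⁅ x ⁆ ∣ ≡ ∣ p ∣
∣p─⁅x⁆∣ p {x} x∈p = trans
  (sym (∣p∪⁅x⁆∣≡1+∣p∣ (p ─ ⁅ x ⁆) λ x∈ → proj₂ (x∈p─q⁻ p ⁅ x ⁆ x∈) (x∈⁅x⁆ x)))
  (cong ∣_∣ (p─⁅x⁆∪⁅x⁆ p x∈p))

module _ {n} (G : Graph n) where
  HasClique HasIndependent : Subset n → ℕ → Set
  HasClique      Y s = ∃[ C ] C ⊆ Y × Clique G C × ∣ C ∣ ≡ s
  HasIndependent Y k = ∃[ I ] I ⊆ Y × Independent G I × ∣ I ∣ ≡ k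

  ramsey-property : ∀ s k {Y} → ramsey s k ≤ ∣ Y ∣ → HasClique Y s ⊎ HasIndependent Y k
  ramsey-property zero    k       _ = inj₁ (⊥ , ⊥⊆ , (λ _ _ u∈ → contradiction u∈ ∉⊥) , ∣⊥∣≡0 n)
  ramsey-property (suc s) zero    _ = inj₂ (⊥ , ⊥⊆ , (λ _ _ u∈ → contradiction u∈ ∉⊥) , ∣⊥∣≡0 n)
  ramsey-property (suc s) (suc k) {Y} large with nonempty? Y
  ... | no empty = contradiction (subst (suc _ ≤_) (trans (cong ∣_∣ (Empty-unique empty)) (∣⊥∣≡0 n)) large) λ ()
  ... | yes (v , v∈Y) = cases (ℕₚ.≤-total (ramsey s (suc k)) ∣ N ∣)
    where
    N? : Decidable (λ u → u ∈ Y × Adj G v u)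
    N? u = (u ∈? Y) ×-dec T? _
    M? : Decidable (λ u → u ∈ Y × u ≢ v × ¬ Adj G v u)
    M? u = (u ∈? Y) ×-dec ¬? (u ≟ᶠ v) ×-dec ¬? (T? _)
    N M : Subset n
    N = select N?
    M = select M?

    split : ∀ {u} → u ∈ Y → u ∈ N ⊎ u ∈ M ∪ ⁅ v ⁆
    split {u} u∈ with u ≟ᶠ v
    ... | yes refl = inj₂ (x∈p∪q⁺ {p = M} (inj₂ (x∈⁅x⁆ v)))
    ... | no u≢v with N? u
    ...   | yes adj = inj₁ (∈-select⁺ N? adj)
    ...   | no ¬adj = inj₂ (x∈p∪q⁺ (inj₁ (∈-select⁺ M? (u∈ , u≢v , λ a → ¬adj (u∈ , a)))))

    v∉M : v ∉ M
    v∉M v∈ = proj₁ (proj₂ (∈-select⁻ M? v∈)) refl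

    bound : ramsey s (suc k) + ramsey (suc s) k ≤ ∣ N ∣ + ∣ M ∣
    bound = ℕ.s≤s⁻¹ (ℕₚ.≤-trans large (ℕₚ.≤-trans (∣p∣≤∣q∣+∣r∣ split)
      (ℕₚ.≤-reflexive (trans (cong (∣ N ∣ +_) (∣p∪⁅x⁆∣≡1+∣p∣ M v∉M)) (ℕₚ.+-suc ∣ N ∣ ∣ M ∣)))))

    withV : ∀ {X} → X ⊆ Y → X ∪ ⁅ v ⁆ ⊆ Y
    withV X⊆Y x∈ with x∈p∪q⁻ _ ⁅ v ⁆ x∈
    ... | inj₁ x∈X = X⊆Y x∈X
    ... | inj₂ x∈v = subst (_∈ Y) (sym (x∈⁅y⁆⇒x≡y v x∈v)) v∈Y

    in-N : HasClique N s ⊎ HasIndependent N (suc k) → HasClique Y (suc s) ⊎ HasIndependent Y (suc k)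
    in-N (inj₂ (I , I⊆N , ind , eq)) = inj₂ (I , proj₁ ∘ ∈-select⁻ N? ∘ I⊆N , ind , eq)
    in-N (inj₁ (C , C⊆N , clq , eq)) = inj₁
      (C ∪ ⁅ v ⁆ , withV (proj₁ ∘ ∈-select⁻ N? ∘ C⊆N) , clique , trans (∣p∪⁅x⁆∣≡1+∣p∣ C v∉C) (cong suc eq))
      where
      v∉C : v ∉ C
      v∉C v∈ = Graph.loopless G v (proj₂ (∈-select⁻ N? (C⊆N v∈)))
      clique : Clique G (C ∪ ⁅ v ⁆)
      clique x y x∈ y∈ x≢y with x∈p∪q⁻ C ⁅ v ⁆ x∈ | x∈p∪q⁻ C ⁅ v ⁆ y∈
      ... | inj₁ x∈C | inj₁ y∈C = clq x y x∈C y∈C x≢y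
      ... | inj₁ x∈C | inj₂ y∈v rewrite x∈⁅y⁆⇒x≡y v y∈v = Adj-sym G (proj₂ (∈-select⁻ N? (C⊆N x∈C)))
      ... | inj₂ x∈v | inj₁ y∈C rewrite x∈⁅y⁆⇒x≡y v x∈v = proj₂ (∈-select⁻ N? (C⊆N y∈C))
      ... | inj₂ x∈v | inj₂ y∈v =
        contradiction (trans (x∈⁅y⁆⇒x≡y v x∈v) (sym (x∈⁅y⁆⇒x≡y v y∈v))) x≢y

    in-M : HasClique M (suc s) ⊎ HasIndependent M k → HasClique Y (suc s) ⊎ HasIndependent Y (suc k)
    in-M (inj₁ (C , C⊆M , clq , eq)) = inj₁ (C , proj₁ ∘ ∈-select⁻ M? ∘ C⊆M , clq , eq)
    in-M (inj₂ (I , I⊆M , ind , eq)) = inj₂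
      (I ∪ ⁅ v ⁆ , withV (proj₁ ∘ ∈-select⁻ M? ∘ I⊆M) , independent , trans (∣p∪⁅x⁆∣≡1+∣p∣ I v∉I) (cong suc eq))
      where
      v∉I : v ∉ I
      v∉I v∈ = v∉M (I⊆M v∈)
      ¬adj : ∀ {x} → x ∈ I → ¬ Adj G v x
      ¬adj x∈ = proj₂ (proj₂ (∈-select⁻ M? (I⊆M x∈)))
      independent : Independent G (I ∪ ⁅ v ⁆)
      independent x y x∈ y∈ with x∈p∪q⁻ I ⁅ v ⁆ x∈ | x∈p∪q⁻ I ⁅ v ⁆ y∈
      ... | inj₁ x∈I | inj₁ y∈I = ind x y x∈I y∈I
      ... | inj₁ x∈I | inj₂ y∈v rewrite x∈⁅y⁆⇒x≡y v y∈v = ¬adj x∈I ∘ Adj-sym G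
      ... | inj₂ x∈v | inj₁ y∈I rewrite x∈⁅y⁆⇒x≡y v x∈v = ¬adj y∈I
      ... | inj₂ x∈v | inj₂ y∈v rewrite x∈⁅y⁆⇒x≡y v x∈v | x∈⁅y⁆⇒x≡y v y∈v = Graph.loopless G v

    cases : ramsey s (suc k) ≤ ∣ N ∣ ⊎ ∣ N ∣ ≤ ramsey s (suc k) → HasClique Y (suc s) ⊎ HasIndependent Y (suc k)
    cases (inj₁ big) = in-N (ramsey-property s (suc k) big)
    cases (inj₂ small) = in-M (ramsey-property (suc s) k
      (ℕₚ.+-cancelˡ-≤ ∣ N ∣ _ _ (ℕₚ.≤-trans (ℕₚ.+-monoˡ-≤ _ small) bound)))

-- Each logarithm in the weight is bounded by a natural number b; N is the sum of these bounds.
data LogWeight≤ {n} : List (Subset n) → ℕ → Set where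
  []  : LogWeight≤ [] 0
  _∷_ : ∀ {C Cs b N} → suc ∣ C ∣ ≤ 2 ^ b → LogWeight≤ Cs N → LogWeight≤ (C ∷ Cs) (b + N)

record CliquePartition {n} (G : Graph n) (Y : Subset n) (N : ℕ) : Set where
  field
    cliques    : List (Subset n)
    areCliques : List.All (Clique G) cliques
    disjoint   : AllPairs (λ C D → Empty (C ∩ D)) cliques
    union      : ⋃ cliques ≡ Y
    weight≤    : LogWeight≤ cliques N

module _ {n} {G : Graph n} where
  open CliquePartition

  []ₚ : CliquePartition G ⊥ 0
  []ₚ .cliques    = []
  []ₚ .areCliques = List.[]
  []ₚ .disjoint   = []
  []ₚ .union      = refl
  []ₚ .weight≤    = []

  consₚ : ∀ {C Y Z b N} → Clique G C → suc ∣ C ∣ ≤ 2 ^ b → (∀ {x} → x ∈ C → x ∉ Y) → C ∪ Y ≡ Z →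
          CliquePartition G Y N → CliquePartition G Z (b + N)
  consₚ {C} {Y} clq le C∩Y≡∅ eq P = record
    { cliques    = C ∷ cliques P
    ; areCliques = clq List.∷ areCliques P
    ; disjoint   = apart (cliques P) (λ x∈ → subst (_ ∈_) (union P) x∈) ∷ disjoint P
    ; union      = trans (cong (C ∪_) (union P)) eq
    ; weight≤    = le ∷ weight≤ P
    }
    where
    apart : ∀ Ds → ⋃ Ds ⊆ Y → List.All (λ D → Empty (C ∩ D)) Ds
    apart []       _  = List.[]
    apart (D ∷ Ds) ⊆Y =
      (λ (x , x∈) → let x∈C , x∈D = x∈p∩q⁻ C D x∈ in C∩Y≡∅ x∈C (⊆Y (p⊆p∪q (⋃ Ds) x∈D)))
      List.∷ apart Ds (⊆Y ∘ q⊆p∪q D (⋃ Ds))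

  singletonsₚ : ∀ r {R Y N} → ∣ R ∣ ≡ r → (∀ {x} → x ∈ R → x ∉ Y) →
                CliquePartition G Y N → CliquePartition G (R ∪ Y) (r + N)
  singletonsₚ r {R} {Y} eq R∩Y≡∅ P with nonempty? R
  singletonsₚ zero {R} {Y} {N} eq R∩Y≡∅ P | no empty =
    subst (λ Z → CliquePartition G Z N) (sym (trans (cong (_∪ Y) (Empty-unique empty)) (∪-identityˡ Y))) P
  singletonsₚ (suc r) eq R∩Y≡∅ P | no empty =
    contradiction (trans (sym eq) (trans (cong ∣_∣ (Empty-unique empty)) (∣⊥∣≡0 n))) λ ()
  singletonsₚ zero {R} eq R∩Y≡∅ P | yes (x , x∈) =
    contradiction (subst₂ _≤_ (∣⁅x⁆∣≡1 x) eq (p⊆q⇒∣p∣≤∣q∣ {p = ⁅ x ⁆} {R} λ y∈ →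
      subst (_∈ R) (sym (x∈⁅y⁆⇒x≡y x y∈)) x∈)) λ ()
  singletonsₚ (suc r) {R} {Y} {N} eq R∩Y≡∅ P | yes (x , x∈) =
    -- A singleton weighs log₂ (1 + 1) = 1.
    consₚ {b = 1} (λ u v u∈ v∈ u≢v → contradiction (trans (x∈⁅y⁆⇒x≡y x u∈) (sym (x∈⁅y⁆⇒x≡y x v∈))) u≢v)
      (s≤s (ℕₚ.≤-reflexive (∣⁅x⁆∣≡1 x))) apart whole
      (singletonsₚ r (ℕₚ.suc-injective (trans (∣p─⁅x⁆∣ R x∈) eq)) (λ y∈ → R∩Y≡∅ (p─q⊆p R ⁅ x ⁆ y∈)) P)
    where
    apart : ∀ {y} → y ∈ ⁅ x ⁆ → y ∉ (R ─ ⁅ x ⁆) ∪ Y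
    apart y∈ y∈′ rewrite x∈⁅y⁆⇒x≡y x y∈ with x∈p∪q⁻ (R ─ ⁅ x ⁆) Y y∈′
    ... | inj₁ x∈R′ = proj₂ (x∈p─q⁻ R ⁅ x ⁆ x∈R′) (x∈⁅x⁆ x)
    ... | inj₂ x∈Y  = R∩Y≡∅ x∈ x∈Y
    whole : ⁅ x ⁆ ∪ ((R ─ ⁅ x ⁆) ∪ Y) ≡ R ∪ Y
    whole = trans (sym (∪-assoc ⁅ x ⁆ (R ─ ⁅ x ⁆) Y))
      (cong (_∪ Y) (trans (∪-comm ⁅ x ⁆ (R ─ ⁅ x ⁆)) (p─⁅x⁆∪⁅x⁆ R x∈)))

  abstract
    -- Cliques of size 2 ^ e are removed greedily until fewer vertices than a Ramsey number remain.
    greedyPartition : ∀ e k {Y} → (∀ {I} → I ⊆ Y → Independent G I → ∣ I ∣ ≤ k) →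
      ∃[ N ] CliquePartition G Y N × 2 ^ e * N ≤ 2 ^ e * ramsey (2 ^ e) (suc k) + ∣ Y ∣ * suc e
    greedyPartition e k {Y} α≤k = go ∣ Y ∣ α≤k ℕₚ.≤-refl
      where
      s M : ℕ
      s = 2 ^ e
      M = ramsey s (suc k)
      open ℕₚ.≤-Reasoning
      lemma : ∀ s a M y → s * a + (s * M + y * a) ≡ s * M + (y + s) * a
      lemma = solve-∀
      go : ∀ l {Y} → (∀ {I} → I ⊆ Y → Independent G I → ∣ I ∣ ≤ k) → ∣ Y ∣ ≤ l →
           ∃[ N ] CliquePartition G Y N × s * N ≤ s * M + ∣ Y ∣ * suc e
      go l {Y} α≤k Y≤l with M ℕₚ.≤? ∣ Y ∣
      ... | no few = ∣ Y ∣ + 0 ,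
        subst (λ Z → CliquePartition G Z (∣ Y ∣ + 0)) (∪-identityʳ Y) (singletonsₚ ∣ Y ∣ refl (λ _ → ∉⊥) []ₚ) ,
        ℕₚ.≤-trans (ℕₚ.*-monoʳ-≤ s (ℕₚ.≤-trans (ℕₚ.≤-reflexive (ℕₚ.+-identityʳ ∣ Y ∣)) (ℕₚ.<⇒≤ (ℕₚ.≰⇒> few))))
          (ℕₚ.m≤m+n _ _)
      ... | yes many with ramsey-property G s (suc k) many
      ...   | inj₂ (I , I⊆Y , ind , eq) = contradiction (subst (_≤ k) eq (α≤k I⊆Y ind)) (ℕₚ.<-irrefl refl)
      ...   | inj₁ (C , C⊆Y , clq , eq) = extend l Y≤l
        where
        Y′ : Subset n
        Y′ = Y ─ C
        size : ∣ Y′ ∣ + s ≤ ∣ Y ∣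
        size = subst (λ c → ∣ Y′ ∣ + c ≤ ∣ Y ∣) eq
          (∣q∣+∣r∣≤∣p∣ (p─q⊆p Y C) C⊆Y λ x∈ → proj₂ (x∈p─q⁻ Y C x∈))
        -- One clique weighs at most e + 1 and uses up 2 ^ e vertices, which is the rate `suc e` per
        -- 2 ^ e vertices in the bound.
        1+s≤ : suc ∣ C ∣ ≤ 2 ^ suc e
        1+s≤ = subst₂ _≤_ (cong suc (sym eq)) (cong (s +_) (sym (ℕₚ.+-identityʳ s)))
          (ℕₚ.+-monoˡ-≤ s (ℕₚ.m^n>0 2 e))
        whole : C ∪ Y′ ≡ Y
        whole = ⊆-antisym fwd bwd
          where
          fwd : C ∪ Y′ ⊆ Y
          fwd x∈ with x∈p∪q⁻ C Y′ x∈
          ... | inj₁ x∈C = C⊆Y x∈C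
          ... | inj₂ x∈Y′ = p─q⊆p Y C x∈Y′
          bwd : Y ⊆ C ∪ Y′
          bwd {x} x∈ with x ∈? C
          ... | yes x∈C = x∈p∪q⁺ (inj₁ x∈C)
          ... | no  x∉C = x∈p∪q⁺ {p = C} (inj₂ (x∈p∧x∉q⇒x∈p─q x∈ x∉C))
        -- `l` only bounds the recursion; it may decrease because 2 ^ e > 0, so that the removed
        -- clique is nonempty.
        extend : ∀ l → ∣ Y ∣ ≤ l → ∃[ N ] CliquePartition G Y N × s * N ≤ s * M + ∣ Y ∣ * suc e
        extend l Y≤l with ℕₚ.≤-trans (ℕₚ.+-monoʳ-≤ ∣ Y′ ∣ (ℕₚ.m^n>0 2 e)) (ℕₚ.≤-trans size Y≤l)
        extend zero    _ | le = contradiction (subst (_≤ 0) (ℕₚ.+-comm ∣ Y′ ∣ 1) le) λ ()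
        extend (suc l) _ | le with go l {Y′} (λ I⊆ → α≤k (p─q⊆p Y C ∘ I⊆))
                                     (ℕ.s≤s⁻¹ (subst (_≤ suc l) (ℕₚ.+-comm ∣ Y′ ∣ 1) le))
        ... | N , P , N≤ = suc e + N ,
          consₚ clq 1+s≤ (λ x∈ x∈′ → proj₂ (x∈p─q⁻ Y C x∈′) x∈) whole P , (begin
            s * (suc e + N)                        ≡⟨ ℕₚ.*-distribˡ-+ s (suc e) N ⟩
            s * suc e + s * N                      ≤⟨ ℕₚ.+-monoʳ-≤ (s * suc e) N≤ ⟩
            s * suc e + (s * M + ∣ Y′ ∣ * suc e)    ≡⟨ lemma s (suc e) M ∣ Y′ ∣ ⟩
            s * M + (∣ Y′ ∣ + s) * suc e            ≤⟨ ℕₚ.+-monoʳ-≤ (s * M) (ℕₚ.*-monoˡ-≤ (suc e) size) ⟩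
            s * M + ∣ Y ∣ * suc e                   ∎)

-- Weights and asymptotics

private
  ≤-frac : ∀ {a b c d} → a * suc d ≤ b * suc c → mkℚᵘ (pos a) c ℚ.≤ mkℚᵘ (pos b) d
  ≤-frac {a} {b} {c} {d} le = ℚ.*≤* (subst₂ ℤ._≤_ (ℤₚ.pos-* a (suc d)) (ℤₚ.pos-* b (suc c)) (ℤ.+≤+ le))

  ≤-frac⁻ : ∀ {a b c d} → mkℚᵘ (pos a) c ℚ.≤ mkℚᵘ (pos b) d → a * suc d ≤ b * suc c
  ≤-frac⁻ {a} {b} {c} {d} (ℚ.*≤* le) = ℤₚ.drop‿+≤+
    (subst₂ ℤ._≤_ (sym (ℤₚ.pos-* a (suc d))) (sym (ℤₚ.pos-* b (suc c))) le)

  +-frac : ∀ a b c → mkℚᵘ (pos a) c ℚ.+ mkℚᵘ (pos b) c ℚ.≃ mkℚᵘ (pos (a + b)) c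
  +-frac a b c = ℚ.*≡* (begin
    (pos a ℤ.* d ℤ.+ pos b ℤ.* d) ℤ.* d  ≡⟨ cong (ℤ._* d) (ℤₚ.*-distribʳ-+ d (pos a) (pos b)) ⟨
    pos (a + b) ℤ.* d ℤ.* d              ≡⟨ ℤₚ.*-assoc (pos (a + b)) d d ⟩
    pos (a + b) ℤ.* (d ℤ.* d)            ≡⟨ cong (pos (a + b) ℤ.*_) (ℤₚ.pos-* (suc c) (suc c)) ⟨
    pos (a + b) ℤ.* pos (suc c * suc c)  ∎)
    where
    open ≡-Reasoning
    d : ℤ.ℤ
    d = pos (suc c)

  *-frac : ∀ a c g → mkℚᵘ (pos a) c ℚ.* fromNat g ℚ.≃ mkℚᵘ (pos (a * g)) c
  *-frac a c g = ℚ.*≡* (cong₂ ℤ._*_ (sym (ℤₚ.pos-* a g)) (cong pos (sym (ℕₚ.*-identityʳ (suc c)))))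

  ≤-slack : ∀ {p q} k → p ℚ.≤ q → p ℚ.≤ q ℚ.+ (1/suc k ℚ.+ 1/suc k)
  ≤-slack {p} {q} k le = ℚₚ.≤-trans le (ℚₚ.≤-trans (ℚₚ.≤-reflexive (ℚₚ.≃-sym (ℚₚ.+-identityʳ q)))
    (ℚₚ.+-monoʳ-≤ q (ℚₚ.nonNegative⁻¹ (1/suc k ℚ.+ 1/suc k))))

-- Termwise, unlike ≤ᵣ, so that it adds up without any loss.
infix 4 _≼_
_≼_ : ℝ → ℕ → Set
x ≼ b = ∀ k → seq x k ℚ.≤ fromNat b

≼⇒≤ᵣ : ∀ {x b} → x ≼ b → x ≤ᵣ fromNatᵣ b
≼⇒≤ᵣ x≼b k = ≤-slack k (x≼b k)

≼-trans : ∀ {x a b} → x ≼ a → a ≤ b → x ≼ b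
≼-trans {a = a} {b} x≼a a≤b k = ℚₚ.≤-trans (x≼a k) (≤-frac {a} {b} (ℕₚ.*-monoˡ-≤ 1 a≤b))

+ᵣ-≼ : ∀ x y {a b} → x ≼ a → y ≼ b → x +ᵣ y ≼ a + b
+ᵣ-≼ x y {a} {b} x≼a y≼b k = ℚₚ.≤-trans (ℚₚ.+-mono-≤ (x≼a _) (y≼b _)) (ℚₚ.≤-reflexive (+-frac a b 0))

log₂-≼ : ∀ {m b} .{{_ : NonZero m}} → m ≤ 2 ^ b → log₂ m ≼ b
log₂-≼ {m} {b} m≤ k = ≤-frac (begin
  ⌊log₂ m ^ suc k ⌋ * 1     ≡⟨ ℕₚ.*-identityʳ _ ⟩
  ⌊log₂ m ^ suc k ⌋         ≤⟨ ⌊log₂⌋-mono-≤ (ℕₚ.^-monoˡ-≤ (suc k) m≤) ⟩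
  ⌊log₂ (2 ^ b) ^ suc k ⌋   ≡⟨ cong ⌊log₂_⌋ (ℕₚ.^-*-assoc 2 b (suc k)) ⟩
  ⌊log₂ 2 ^ (b * suc k) ⌋   ≡⟨ ⌊log₂[2^n]⌋≡n (b * suc k) ⟩
  b * suc k                 ∎)
  where open ℕₚ.≤-Reasoning

totalLog : ∀ {n} → List (Subset n) → ℝ
totalLog = foldr (λ C w → log₂ (suc ∣ C ∣) +ᵣ w) (fromNatᵣ 0)

totalLog-≼ : ∀ {n} {Cs : List (Subset n)} {N} → LogWeight≤ Cs N → totalLog Cs ≼ N
totalLog-≼ []       k = ℚₚ.≤-refl
totalLog-≼ {Cs = C ∷ Cs} (_∷_ {b = b} {N} le w) =
  +ᵣ-≼ (log₂ (suc ∣ C ∣)) (totalLog Cs) {b} {N} (log₂-≼ {suc ∣ C ∣} {b} le) (totalLog-≼ w)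

3/4 : ℚᵘ
3/4 = mkℚᵘ (pos 3) 3

3/4<1 : fromℚ 3/4 <ᵣ fromNatᵣ 1
-- 8 is the least index that works: 3/4 + 2/9 = 35/36, while index 7 gives 3/4 + 2/8 = 1.
3/4<1 = 8 , ℚ.*<* (ℤ.+<+ (ℕₚ.<ᵇ⇒< _ _ _))

seq-·3/4 : ∀ n k → seq (n · fromℚ 3/4) k ℚ.≃ mkℚᵘ (pos (3 * n)) 3
seq-·3/4 zero    k = ℚ.*≡* refl
seq-·3/4 (suc n) k = ℚₚ.≃-trans (ℚₚ.+-congʳ 3/4 (seq-·3/4 n _)) (ℚₚ.≃-trans (+-frac 3 (3 * n) 3)
  (ℚₚ.≃-reflexive (cong (λ a → mkℚᵘ (pos a) 3) (sym (ℕₚ.*-suc 3 n)))))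

balanced-3/4 : ∀ {n m} → 4 * m ≤ 3 * n → fromNatᵣ m ≤ᵣ n · fromℚ 3/4
balanced-3/4 {n} {m} le k = ≤-slack k (ℚₚ.≤-trans
  (≤-frac (subst₂ _≤_ (ℕₚ.*-comm 4 m) (sym (ℕₚ.*-identityʳ (3 * n))) le))
  (ℚₚ.≤-reflexive (ℚₚ.≃-sym (seq-·3/4 n k))))

-- A positive rational with denominator `suc d` is at least 1 / (d + 1), so it is enough to treat
-- these values and to clear the denominator.
fromNatᵣ-∈o : ∀ (f g : ℕ → ℕ) → (∀ d → ∃[ N ] ∀ n → N ≤ n → suc d * f n ≤ g n) →
              (λ n → fromNatᵣ (f n)) ∈o g
fromNatᵣ-∈o f g small (mkℚᵘ (pos 0)      d) (ℚ.*<* (ℤ.+<+ ()))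
fromNatᵣ-∈o f g small (mkℚᵘ -[1+ _ ] d) (ℚ.*<* ())
fromNatᵣ-∈o f g small (mkℚᵘ +[1+ a ] d) _ with small d
... | N , bound = N , λ n N≤n →
    (λ k → ≤-slack k (ℚₚ.≤-trans
      (ℚₚ.neg-mono-≤ (ℚₚ.≤-trans (≤-frac {0} {suc a * g n} {0} {d} z≤n) (≥ε n)))
      (≤-frac {0} {f n} {0} {0} z≤n))) ,
    (λ k → ≤-slack k (ℚₚ.≤-trans (≤-frac (above n (bound n N≤n))) (≥ε n)))
  where
  ≥ε : ∀ n → mkℚᵘ (pos (suc a * g n)) d ℚ.≤ mkℚᵘ +[1+ a ] d ℚ.* fromNat (g n)
  ≥ε n = ℚₚ.≤-reflexive (ℚₚ.≃-sym (*-frac (suc a) d (g n)))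
  above : ∀ n → suc d * f n ≤ g n → f n * suc d ≤ suc a * g n * 1
  above n le = begin
    f n * suc d     ≡⟨ ℕₚ.*-comm (f n) (suc d) ⟩
    suc d * f n     ≤⟨ le ⟩
    g n             ≤⟨ ℕₚ.m≤n*m (g n) (suc a) ⟩
    suc a * g n     ≡⟨ ℕₚ.*-identityʳ _ ⟨
    suc a * g n * 1 ∎
    where open ℕₚ.≤-Reasoning

-- At index 0 the slack in the definition of ≤ᵣ is 2.
bound-below : ∀ (f : ℕ → ℝ) b → ∃[ N ] ∀ m x → x ≤ b → fromNatᵣ m ≤ᵣ f x → m ≤ N
bound-below f b = go b
  where
  ceiling : ∀ q → ∃[ N ] ∀ {m} → fromNat m ℚ.≤ q → m ≤ N
  ceiling (mkℚᵘ (pos a) d) = a , λ {m} le → ℕₚ.≤-trans (ℕₚ.m≤m*n m (suc d))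
    (subst (m * suc d ≤_) (ℕₚ.*-identityʳ a) (≤-frac⁻ {m} {a} {0} {d} le))
  ceiling (mkℚᵘ -[1+ a ] d) = 0 , λ {m} le → contradiction (ℚₚ.≤-trans (≤-frac {0} {m} {0} {0} z≤n) le)
    λ { (ℚ.*≤* ()) }
  go : ∀ b → ∃[ N ] ∀ m x → x ≤ b → fromNatᵣ m ≤ᵣ f x → m ≤ N
  go zero with ceiling (seq (f 0) 0 ℚ.+ (1/suc 0 ℚ.+ 1/suc 0))
  ... | N , below = N , λ { m 0 z≤n le → below {m} (le 0) }
  go (suc b) with go b | ceiling (seq (f (suc b)) 0 ℚ.+ (1/suc 0 ℚ.+ 1/suc 0))
  ... | N , below | N′ , below′ = N ⊔ N′ , λ m x x≤ le → cases m x x≤ le (ℕₚ.m≤n⇒m<n∨m≡n x≤)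
    where
    cases : ∀ m x → x ≤ suc b → fromNatᵣ m ≤ᵣ f x → x < suc b ⊎ x ≡ suc b → m ≤ N ⊔ N′
    cases m x _ le (inj₁ (s≤s x≤b)) = ℕₚ.≤-trans (below m x x≤b le) (ℕₚ.m≤m⊔n N N′)
    cases m x _ le (inj₂ refl)      = ℕₚ.≤-trans (below′ {m} (le 0)) (ℕₚ.m≤n⊔m N N′)

linear≤exponential : ∀ D → ∃[ E ] ∀ e → E ≤ e → D * (e + 3) ≤ 2 ^ e
linear≤exponential D = E , λ e E≤e → subst (λ e → D * (e + 3) ≤ 2 ^ e) (ℕₚ.m∸n+n≡m E≤e) (go (e ∸ E))
  where
  open ℕₚ.≤-Reasoning
  E : ℕ
  -- From D ≤ 2 ^ D and 8 ≤ 30 · 2 ^ D one gets D (2 D + 8) ≤ 2 ^ D · 32 · 2 ^ D = 2 ^ (2 D + 5).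
  E = D + (D + 5)
  n≤2^n : ∀ n → n ≤ 2 ^ n
  n≤2^n zero    = z≤n
  n≤2^n (suc n) = subst (suc n ≤_) (cong (2 ^ n +_) (sym (ℕₚ.+-identityʳ (2 ^ n))))
    (ℕₚ.+-mono-≤ (ℕₚ.m^n>0 2 n) (n≤2^n n))
  lemma₁ : ∀ D → D + (D + 5) + 3 ≡ 2 * D + 8
  lemma₁ = solve-∀
  lemma₂ : ∀ x → 2 * x + 30 * x ≡ x * 32
  lemma₂ = solve-∀
  lemma₃ : ∀ D e → D * (suc e + 3) ≡ D * (e + 3) + D * 1
  lemma₃ = solve-∀
  base : D * (E + 3) ≤ 2 ^ E
  base = begin
    D * (E + 3)                 ≡⟨ cong (D *_) (lemma₁ D) ⟩
    D * (2 * D + 8)             ≤⟨ ℕₚ.*-mono-≤ (n≤2^n D) (ℕₚ.+-mono-≤ (ℕₚ.*-monoʳ-≤ 2 (n≤2^n D))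
                                     (ℕₚ.≤-trans (ℕₚ.m≤m+n 8 22) (ℕₚ.*-monoʳ-≤ 30 (ℕₚ.m^n>0 2 D)))) ⟩
    2 ^ D * (2 * 2 ^ D + 30 * 2 ^ D) ≡⟨ cong (2 ^ D *_) (lemma₂ (2 ^ D)) ⟩
    2 ^ D * (2 ^ D * 2 ^ 5)     ≡⟨ cong (2 ^ D *_) (ℕₚ.^-distribˡ-+-* 2 D 5) ⟨
    2 ^ D * 2 ^ (D + 5)         ≡⟨ ℕₚ.^-distribˡ-+-* 2 D (D + 5) ⟨
    2 ^ E                       ∎
  go : ∀ j → D * (j + E + 3) ≤ 2 ^ (j + E)
  go zero    = base
  go (suc j) = begin
    D * (suc (j + E) + 3)                 ≡⟨ lemma₃ D (j + E) ⟩
    D * (j + E + 3) + D * 1               ≤⟨ ℕₚ.+-monoʳ-≤ _ (ℕₚ.*-monoʳ-≤ D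
                                               (ℕₚ.≤-trans (s≤s z≤n) (ℕₚ.m≤n+m 3 (j + E)))) ⟩
    D * (j + E + 3) + D * (j + E + 3)     ≤⟨ ℕₚ.+-mono-≤ (go j) (go j) ⟩
    2 ^ (j + E) + 2 ^ (j + E)             ≡⟨ cong (2 ^ (j + E) +_) (ℕₚ.+-identityʳ _) ⟨
    2 ^ suc (j + E)                       ∎

-- Any exponent e that tends to infinity so slowly that 2 ^ e * M e ≤ n would do.
module Sublinear (M : ℕ → ℕ) where
  private
    good? : ∀ n → Decidable (λ e → 2 ^ e * M e ≤ n)
    good? n e = 2 ^ e * M e ℕₚ.≤? n

  exponent : ℕ → ℕ
  exponent n = greatest (good? n) n

  -- An upper bound for 2 ^ e times the weight: the leftover singletons, then `n` for the deleted
  -- layers and `n * suc e` for the large cliques.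
  total : ℕ → ℕ → ℕ
  total n e = 2 ^ e * M e + n * (e + 2)

  weightBound : ℕ → ℕ
  weightBound n = (total n (exponent n) / 2 ^ exponent n) {{ℕₚ.m^n≢0 2 (exponent n)}}

  ≤weightBound : ∀ n {N} → 2 ^ exponent n * N ≤ total n (exponent n) → N ≤ weightBound n
  ≤weightBound n {N} le = subst (_≤ weightBound n) (m*n/n≡m N (2 ^ e) {{2^e≢0}})
    (/-monoˡ-≤ (2 ^ e) {{2^e≢0}} (subst (_≤ total n e) (ℕₚ.*-comm (2 ^ e) N) le))
    where
    e = exponent n
    2^e≢0 = ℕₚ.m^n≢0 2 e

  weightBound-sublinear : ∀ d → ∃[ N ] ∀ n → N ≤ n → suc d * weightBound n ≤ n
  weightBound-sublinear d with linear≤exponential (suc d)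
  ... | E , exp = N , λ n N≤n →
      let e = exponent n
          E≤e = greatest-bounds (good? n) n
                  (ℕₚ.≤-trans (ℕₚ.≤-trans (ℕₚ.m≤m+n _ (2 ^ 0 * M 0)) (ℕₚ.m≤n+m _ E)) N≤n)
                  (ℕₚ.≤-trans (ℕₚ.m≤m+n E _) N≤n)
          good = greatest-holds (good? n) n
                  (ℕₚ.≤-trans (ℕₚ.≤-trans (ℕₚ.m≤n+m _ (2 ^ E * M E)) (ℕₚ.m≤n+m _ E)) N≤n)
          w = weightBound n
      in ℕₚ.*-cancelʳ-≤ (suc d * w) n (2 ^ e) {{ℕₚ.m^n≢0 2 e}} (begin
        suc d * w * 2 ^ e                   ≡⟨ ℕₚ.*-assoc (suc d) w (2 ^ e) ⟩
        suc d * (w * 2 ^ e)                 ≤⟨ ℕₚ.*-monoʳ-≤ (suc d)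
                                                 (m/n*n≤m (total n e) (2 ^ e) {{ℕₚ.m^n≢0 2 e}}) ⟩
        suc d * total n e                   ≤⟨ ℕₚ.*-monoʳ-≤ (suc d) (ℕₚ.+-monoˡ-≤ (n * (e + 2)) good) ⟩
        suc d * (n + n * (e + 2))           ≡⟨ lemma (suc d) n e ⟩
        n * (suc d * (e + 3))               ≤⟨ ℕₚ.*-monoʳ-≤ n (exp e E≤e) ⟩
        n * 2 ^ e                           ∎)
    where
    open ℕₚ.≤-Reasoning
    -- The three summands ensure E ≤ n, that `E` is a good exponent, so that the chosen one is at
    -- least `E`, and that 0 is good, so that `greatest` does not fall back on its default.
    N = E + (2 ^ E * M E + 2 ^ 0 * M 0)
    lemma : ∀ D n e → D * (n + n * (e + 2)) ≡ n * (D * (e + 3))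
    lemma = solve-∀

-- A bound on the number of singletons that the greedy partition of Y leaves.
leftover : ℕ → ℕ → ℕ
leftover ℓ e = ramsey (2 ^ e) (suc (2 ^ e * ℓ))

cliqueSeparator : ∀ {n ℓ} {G : Graph n} e {b} → LayeredTreeIndependenceNumber≤ ℓ G →
  (∀ {N} → 2 ^ e * N ≤ 2 ^ e * leftover ℓ e + n * (e + 2) → N ≤ b) →
  Σ (CliqueBasedSeparator (fromℚ 3/4) G) λ 𝒮 → weight 𝒮 ≤ᵣ fromNatᵣ b
cliqueSeparator {n} {ℓ} {G} e {b} (D , L , α≤) ≤b
  with layered-separator D L (2 ^ e) {{ℕₚ.m^n≢0 2 e}}
... | R , Y , R-small , (pieces , half) , Y-bounded
  with greedyPartition {G = G} e (2 ^ e * ℓ) {Y ─ R} (λ I⊆ → Y-bounded α≤ (p─q⊆p Y R ∘ I⊆))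
     | balancedSeparation pieces half
...   | N , P , N≤ | sep , A∩B≡ , few , few′ = separator ,
      ≼⇒≤ᵣ {weight separator} {b} (≼-trans {weight separator} (totalLog-≼ weight≤) (≤b total≤))
    where
    -- The median slab includes its deleted layer, so `Y` may meet `R`; the large cliques are taken
    -- from `Y ─ R` to keep all cliques disjoint.
    Q : CliquePartition G (R ∪ (Y ─ R)) (∣ R ∣ + N)
    Q = singletonsₚ ∣ R ∣ refl (λ x∈R x∈ → proj₂ (x∈p─q⁻ Y R x∈) x∈R) P
    open CliquePartition Q
    M : ℕ
    M = leftover ℓ e
    total≤ : 2 ^ e * (∣ R ∣ + N) ≤ 2 ^ e * M + n * (e + 2)
    total≤ = begin
      2 ^ e * (∣ R ∣ + N)                             ≡⟨ ℕₚ.*-distribˡ-+ (2 ^ e) ∣ R ∣ N ⟩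
      2 ^ e * ∣ R ∣ + 2 ^ e * N                       ≤⟨ ℕₚ.+-mono-≤ R-small N≤ ⟩
      n + (2 ^ e * M + ∣ Y ─ R ∣ * suc e)             ≤⟨ ℕₚ.+-monoʳ-≤ n (ℕₚ.+-monoʳ-≤ (2 ^ e * M)
                                                          (ℕₚ.*-monoˡ-≤ (suc e) (∣p∣≤n (Y ─ R)))) ⟩
      n + (2 ^ e * M + n * suc e)                     ≡⟨ lemma n (2 ^ e * M) e ⟩
      2 ^ e * M + n * (e + 2)                         ∎
      where
      open ℕₚ.≤-Reasoning
      lemma : ∀ n m e → n + (m + n * suc e) ≡ m + n * (e + 2)
      lemma = solve-∀
    R∪Y≡ : R ∪ (Y ─ R) ≡ R ∪ Y
    R∪Y≡ = ⊆-antisym fwd bwd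
      where
      fwd : R ∪ (Y ─ R) ⊆ R ∪ Y
      fwd x∈ with x∈p∪q⁻ R (Y ─ R) x∈
      ... | inj₁ x∈R = x∈p∪q⁺ (inj₁ x∈R)
      ... | inj₂ x∈  = x∈p∪q⁺ {p = R} (inj₂ (p─q⊆p Y R x∈))
      bwd : R ∪ Y ⊆ R ∪ (Y ─ R)
      bwd {x} x∈ with x ∈? R | x∈p∪q⁻ R Y x∈
      ... | yes x∈R | _        = x∈p∪q⁺ (inj₁ x∈R)
      ... | no  x∉R | inj₁ x∈R = contradiction x∈R x∉R
      ... | no  x∉R | inj₂ x∈Y = x∈p∪q⁺ {p = R} (inj₂ (x∈p∧x∉q⇒x∈p─q x∈Y x∉R))
    separator : CliqueBasedSeparator (fromℚ 3/4) G
    separator = record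
      { cliques    = cliques
      ; areCliques = areCliques
      ; disjoint   = disjoint
      ; separation = sep
      ; balanced   = balanced-3/4 {n} {∣ A ─ B ∣ ⊔ ∣ B ─ A ∣}
          (subst (_≤ 3 * n) (sym (ℕₚ.*-distribˡ-⊔ 4 ∣ A ─ B ∣ ∣ B ─ A ∣)) (ℕₚ.⊔-lub few few′))
      ; union      = trans union (trans R∪Y≡ (sym A∩B≡))
      }
      where open Separation sep

boundedLayered⇒sublinear : BoundedLayeredTreeIndependenceNumber Implies SublinearCliqueBasedSeparators
boundedLayered⇒sublinear 𝒢 (ℓ , layered) =
  fromℚ 3/4 , 3/4<1 , (λ n → fromNatᵣ (weightBound n)) ,
  fromNatᵣ-∈o weightBound id weightBound-sublinear ,
  λ {n} G G∈ → cliqueSeparator (exponent n) (layered G G∈) (≤weightBound n)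
  where open Sublinear (leftover ℓ)

-- Tools for the graph classes that separate the properties

α≤ : ∀ {n} (G : Graph n) S {k} → (∀ {I} → I ⊆ S → Independent G I → ∣ I ∣ ≤ k) → α G S ≤ k
α≤ G S bound with α-attained G S
... | I , I⊆S , ind , eq = subst (_≤ _) eq (bound I⊆S ind)

α≤card : ∀ {n} (G : Graph n) S → α G S ≤ ∣ S ∣
α≤card G S = α≤ G S λ I⊆S _ → p⊆q⇒∣p∣≤∣q∣ I⊆S

θ≤card : ∀ {n} (G : Graph n) S → θ G S ≤ ∣ S ∣
θ≤card {n} G S = θ-minimal G S (cover ∣ S ∣ refl)
  where
  cover : ∀ r {S} → ∣ S ∣ ≡ r → HasCliqueCover G S r
  cover r {S} eq with nonempty? S
  cover zero    eq | no empty = [] , [] , sym (Empty-unique empty)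
  cover (suc r) eq | no empty =
    contradiction (trans (sym eq) (trans (cong ∣_∣ (Empty-unique empty)) (∣⊥∣≡0 n))) λ ()
  cover zero    {S} eq | yes (x , x∈) = contradiction (trans (∣p─⁅x⁆∣ S x∈) eq) λ ()
  cover (suc r) {S} eq | yes (x , x∈)
    with cover r {S ─ ⁅ x ⁆} (ℕₚ.suc-injective (trans (∣p─⁅x⁆∣ S x∈) eq))
  ... | Cs , cliques , union = ⁅ x ⁆ ∷ Cs ,
    (λ u v u∈ v∈ u≢v → contradiction (trans (x∈⁅y⁆⇒x≡y x u∈) (sym (x∈⁅y⁆⇒x≡y x v∈))) u≢v) ∷ cliques ,
    trans (cong (⁅ x ⁆ ∪_) union) (trans (∪-comm ⁅ x ⁆ (S ─ ⁅ x ⁆)) (p─⁅x⁆∪⁅x⁆ S x∈))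

module _ {n} {R : Fin n → Fin n → Set} (R? : ∀ u v → Dec (R u v))
         (R-sym : ∀ {u v} → R u v → R v u) (R-irrefl : ∀ {v} → ¬ R v v) where
  fromRelation : Graph n
  fromRelation .Graph.adj u v = ⌊ R? u v ⌋
  fromRelation .Graph.symmetric u v with R? u v | R? v u
  ... | yes _ | yes _ = refl
  ... | no  _ | no  _ = refl
  ... | yes r | no ¬r = contradiction (R-sym r) ¬r
  ... | no ¬r | yes r = contradiction (R-sym r) ¬r
  fromRelation .Graph.loopless v = R-irrefl ∘ toWitness

module _ {n} (G : Graph n) where
  singleBag : TreeDecomposition G
  singleBag = record
    { tree     = point
    ; isTree   = record
      { nonEmpty  = _
      ; connected = λ { {zero} {zero} _ _ → ε }
      ; acyclic   = λ c → Cycle.step c zero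
      }
    ; bag      = λ _ → ⊤
    ; vertices = λ _ → zero , ∈⊤
    ; edges    = λ _ _ _ → zero , ∈⊤ , ∈⊤
    ; subtree  = λ { _ {zero} {zero} _ _ → ε }
    }
    where
    point : Graph 1
    point = record { adj = λ _ _ → false ; symmetric = λ _ _ → refl ; loopless = λ _ () }

  oneLayer : Layering G
  oneLayer = record { index = λ _ → 0 ; adjacent = λ _ _ _ → z≤n }

-- Turns balance into a lower bound: a single piece holds at most half of the vertices, so whatever
-- is outside it makes up the other half.
large-complement : ∀ {n} {G : Graph n} {X} (𝒫 : Pieces G X) → Pieces.AtMostHalf 𝒫 → ∀ Z c →
  (∀ {v} → v ∉ Z → v ∈ Pieces.piece 𝒫 c) → n ≤ 2 * ∣ Z ∣
large-complement {n} 𝒫 half Z c rest⊆piece = ℕₚ.+-cancelʳ-≤ n _ _ (begin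
  n + n                       ≡⟨ cong (n +_) (ℕₚ.+-identityʳ n) ⟨
  2 * n                       ≡⟨ cong (2 *_) (∣⊤∣≡n n) ⟨
  2 * ∣ ⊤ {n} ∣               ≤⟨ ℕₚ.*-monoʳ-≤ 2 (∣p∣≤∣q∣+∣r∣ {p = ⊤} λ {v} _ → split v) ⟩
  2 * (∣ Z ∣ + ∣ piece c ∣)   ≡⟨ ℕₚ.*-distribˡ-+ 2 ∣ Z ∣ ∣ piece c ∣ ⟩
  2 * ∣ Z ∣ + 2 * ∣ piece c ∣ ≤⟨ ℕₚ.+-monoʳ-≤ (2 * ∣ Z ∣) (half c) ⟩
  2 * ∣ Z ∣ + n               ∎)
  where
  open ℕₚ.≤-Reasoning
  open Pieces 𝒫
  split : ∀ v → v ∈ Z ⊎ v ∈ piece c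
  split v with v ∈? Z
  ... | yes v∈ = inj₁ v∈
  ... | no  v∉ = inj₂ (rest⊆piece v∉)

-- Complete graphs and complements of shift graphs

module _ (n : ℕ) where
  complete : Graph n
  complete = fromRelation (λ u v → ¬? (u ≟ᶠ v)) (λ u≢v → u≢v ∘ sym) (λ v≢v → v≢v refl)

  complete-clique : ∀ S → Clique complete S
  complete-clique S u v _ _ u≢v = fromWitness {a? = ¬? (u ≟ᶠ v)} u≢v

  complete-α≤1 : ∀ S → α complete S ≤ 1
  complete-α≤1 S = α≤ complete S λ {I} _ ind → ∣p∣≤1 I λ {u} {v} u∈ v∈ →
    decidable-stable (u ≟ᶠ v) λ u≢v → ind u v u∈ v∈ (complete-clique I u v u∈ v∈ u≢v)

  complete-θ≤1 : ∀ S → θ complete S ≤ 1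
  complete-θ≤1 S = θ-minimal complete S (S ∷ [] , complete-clique S ∷ [] , ∪-identityʳ S)

-- At least half of the vertices lie in one bag, and they occupy at most three layers.
complete-layeredTreewidth : ∀ {m ℓ} → LayeredTreewidth≤ ℓ (complete (suc m)) → suc m ≤ 2 * (3 * ℓ)
complete-layeredTreewidth {m} {ℓ} (D , L , narrow) with balancedBag D
... | t , 𝒫 , half = ℕₚ.≤-trans (large 𝒫 half (any? λ v → ¬? (v ∈? X))) (ℕₚ.*-monoʳ-≤ 2 size)
  where
  open Layering L using (index; adjacent)
  X : Subset (suc m)
  X = bag D t

  large : (𝒫 : Pieces (complete (suc m)) X) → Pieces.AtMostHalf 𝒫 → Dec (∃[ v ] v ∉ X) → suc m ≤ 2 * ∣ X ∣
  large 𝒫 half (no none)      = large-complement 𝒫 half X 0 λ {v} v∉ → contradiction (v , v∉) none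
  large 𝒫 half (yes (w , w∉)) = large-complement 𝒫 half X (label w) λ {v} v∉ →
    ∈-select⁺ (inPiece? (label w)) (v∉ , same v v∉ (v ≟ᶠ w))
    where
    open Pieces 𝒫
    same : ∀ v → v ∉ X → Dec (v ≡ w) → label v ≡ label w
    same v v∉ (yes refl) = refl
    same v v∉ (no v≢w)   = constant v∉ w∉ (complete-clique (suc m) ⊤ v w ∈⊤ ∈⊤ v≢w)

  center : Fin 3 → ℕ
  -- Used only for a `v` with `suc (index v) ≡ index zero`, so the truncation in `∸` does no harm.
  center zero             = index zero ∸ 1
  center (suc zero)       = index zero
  center (suc (suc zero)) = suc (index zero)

  near-zero : ∀ v → ∃[ u ] index v ≡ center u
  near-zero zero    = suc zero , refl
  near-zero (suc v) with ∣a-b∣≤1⁻ _ _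
    (adjacent (suc v) zero (complete-clique (suc m) ⊤ (suc v) zero ∈⊤ ∈⊤ λ ()))
  ... | inj₁ eq        = suc zero , eq
  ... | inj₂ (inj₁ eq) = zero , cong (_∸ 1) eq
  ... | inj₂ (inj₂ eq) = suc (suc zero) , eq

  size : ∣ X ∣ ≤ 3 * ℓ
  size = cover-bound X (⊤ {3}) (λ u → X ∩ layer L (center u))
    (λ {v} v∈ → let u , eq = near-zero v in
      u , ∈⊤ , x∈p∩q⁺ (v∈ , ∈-select⁺ (λ v → index v ℕₚ.≟ center u) eq))
    (λ u → narrow t (center u))

∈⋃⁻ : ∀ {n k} (Cs : Vec (Subset n) k) {x} → x ∈ ⋃ (toList Cs) → ∃[ i ] x ∈ lookup Cs i
∈⋃⁻ []       x∈ = contradiction x∈ ∉⊥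
∈⋃⁻ (C ∷ Cs) x∈ with x∈p∪q⁻ C _ x∈
... | inj₁ x∈C = zero , x∈C
... | inj₂ x∈  = let i , x∈ᵢ = ∈⋃⁻ Cs x∈ in suc i , x∈ᵢ

module _ (N : ℕ) where
  private
    lo hi : Fin (N * N) → Fin N
    lo = proj₁ ∘ remQuot {N} N
    hi = proj₂ ∘ remQuot {N} N

  -- Arcs (i , j) → (j , l) of the shift graph, with i < j. Pairs that are not increasing stay as
  -- vertices without outgoing arcs, so that the vertex set is a full square.
  Arc : Fin (N * N) → Fin (N * N) → Set
  Arc u v = lo u Fin.< hi u × hi u ≡ lo v

  arc? : ∀ u v → Dec (Arc u v)
  arc? u v = (lo u Finₚ.<? hi u) ×-dec (hi u ≟ᶠ lo v)

  coShift? : ∀ u v → Dec (u ≢ v × ¬ Arc u v × ¬ Arc v u)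
  coShift? u v = ¬? (u ≟ᶠ v) ×-dec ¬? (arc? u v) ×-dec ¬? (arc? v u)

  coShift : Graph (N * N)
  coShift = fromRelation coShift?
    (λ (u≢v , ¬uv , ¬vu) → u≢v ∘ sym , ¬vu , ¬uv) (λ (v≢v , _) → v≢v refl)

  arc-< : ∀ {u v} → Arc u v → lo u Fin.< lo v
  arc-< (lt , eq) = subst (_ Fin.<_) eq lt

  no-fork : ∀ {u v w} → Arc u v → Arc u w → ¬ (Arc v w ⊎ Arc w v)
  no-fork (_ , e) (_ , e′) (inj₁ a) = Finₚ.<-irrefl (trans (sym e) e′) (arc-< a)
  no-fork (_ , e) (_ , e′) (inj₂ a) = Finₚ.<-irrefl (trans (sym e′) e) (arc-< a)

  no-cycle : ∀ {u v w} → Arc u v → Arc v w → ¬ Arc w u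
  no-cycle a b c = Finₚ.<-irrefl refl (Finₚ.<-trans (Finₚ.<-trans (arc-< a) (arc-< b)) (arc-< c))

  -- A triangle is a directed cycle, impossible as `lo` increases along arcs, or it has a vertex
  -- with two outgoing arcs; their heads then share `lo`, so no arc joins them.
  no-triangle : ∀ {u v w} → Arc u v ⊎ Arc v u → Arc v w ⊎ Arc w v → ¬ (Arc u w ⊎ Arc w u)
  no-triangle (inj₁ uv) vw        (inj₁ uw) = no-fork uv uw vw
  no-triangle (inj₁ uv) (inj₁ vw) (inj₂ wu) = no-cycle uv vw wu
  no-triangle (inj₁ uv) (inj₂ wv) (inj₂ wu) = no-fork wv wu (inj₂ uv)
  no-triangle (inj₂ vu) (inj₁ vw) uw        = no-fork vu vw uw
  no-triangle (inj₂ vu) (inj₂ wv) (inj₁ uw) = no-cycle vu uw wv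
  no-triangle (inj₂ vu) (inj₂ wv) (inj₂ wu) = no-fork wv wu (inj₁ vu)

  arcs : ∀ {I u v} → Independent coShift I → u ∈ I → v ∈ I → u ≢ v → Arc u v ⊎ Arc v u
  arcs {u = u} {v} ind u∈ v∈ u≢v with arc? u v | arc? v u
  ... | yes a | _     = inj₁ a
  ... | no _  | yes a = inj₂ a
  ... | no ¬a | no ¬b = contradiction (fromWitness {a? = coShift? u v} (u≢v , ¬a , ¬b)) (ind u v u∈ v∈)

  coShift-α≤2 : ∀ S → α coShift S ≤ 2
  coShift-α≤2 S = α≤ coShift S λ {I} _ ind → bound I ind (nonempty? I)
    where
    bound : ∀ I → Independent coShift I → Dec (Nonempty I) → ∣ I ∣ ≤ 2
    bound I ind (no empty) = ℕₚ.≤-trans (∣p∣≤1 I λ x∈ → contradiction (_ , x∈) empty) (s≤s z≤n)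
    bound I ind (yes (x , x∈)) = subst (_≤ 2) (∣p─⁅x⁆∣ I x∈) (s≤s (∣p∣≤1 (I ─ ⁅ x ⁆) λ {y} {z} y∈ z∈ →
      decidable-stable (y ≟ᶠ z) λ y≢z → no-triangle
        (arcs ind x∈ (in-I y∈) (x≢ y∈)) (arcs ind (in-I y∈) (in-I z∈) y≢z) (arcs ind x∈ (in-I z∈) (x≢ z∈))))
      where
      in-I : ∀ {y} → y ∈ I ─ ⁅ x ⁆ → y ∈ I
      in-I = p─q⊆p I ⁅ x ⁆
      x≢ : ∀ {y} → y ∈ I ─ ⁅ x ⁆ → x ≢ y
      x≢ y∈ refl = proj₂ (x∈p─q⁻ I ⁅ x ⁆ y∈) (x∈⁅x⁆ x)

  -- The indices of the cliques that contain a pair (i , l) with i < l determine i.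
  coShift-cover : ∀ {k} → HasCliqueCover coShift ⊤ k → N ≤ 2 ^ k
  coShift-cover {k} (Cs , cliques , union) = injective⇒≤ {f = funToFin ∘ colours} λ {i} {j} eq →
    distinct i j λ c → trans (sym (finToFun-funToFin (colours i) c))
      (trans (cong (λ x → finToFun x c) eq) (finToFun-funToFin (colours j) c))
    where
    Colour : Fin N → Fin k → Set
    Colour i c = ∃[ l ] i Fin.< l × combine i l ∈ lookup Cs c
    colour? : ∀ i c → Dec (Colour i c)
    colour? i c = any? λ l → (i Finₚ.<? l) ×-dec (combine i l ∈? lookup Cs c)
    colours : Fin N → Fin k → Fin 2
    colours i c with colour? i c
    ... | yes _ = suc zero
    ... | no  _ = zero
    transfer : ∀ i j c → colours i c ≡ colours j c → Colour i c → Colour j c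
    transfer i j c eq col with colour? i c | colour? j c
    ... | _     | yes col′ = col′
    ... | no ¬c | no _     = contradiction col ¬c
    transfer i j c () col | yes _ | no _
    no-common : ∀ {i j} c → i Fin.< j → combine i j ∈ lookup Cs c → ¬ Colour j c
    no-common {i} {j} c i<j ij∈ (l , j<l , jl∈) =
      proj₁ (proj₂ (toWitness {a? = coShift? ij jl} (clique ij jl ij∈ jl∈ ij≢jl)))
        (subst₂ Fin._<_ (sym lo-ij) (sym hi-ij) i<j , trans hi-ij (sym lo-jl))
      where
      ij jl : Fin (N * N)
      ij = combine i j
      jl = combine j l
      clique : Clique coShift (lookup Cs c)
      clique = lookupAll cliques c
        where
        lookupAll : ∀ {m} {Cs : Vec (Subset (N * N)) m} → All (Clique coShift) Cs →
                    ∀ c → Clique coShift (lookup Cs c)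
        lookupAll (clq ∷ _)    zero    = clq
        lookupAll (_ ∷ cliques) (suc c) = lookupAll cliques c
      lo-ij : lo ij ≡ i
      lo-ij = cong proj₁ (remQuot-combine i j)
      hi-ij : hi ij ≡ j
      hi-ij = cong proj₂ (remQuot-combine i j)
      lo-jl : lo jl ≡ j
      lo-jl = cong proj₁ (remQuot-combine j l)
      ij≢jl : ij ≢ jl
      ij≢jl eq = Finₚ.<-irrefl (trans (sym lo-ij) (trans (cong lo eq) lo-jl)) i<j
    -- The pair (i , j) lies in some clique `c`, which makes `c` a colour of `i`. If it is one of
    -- `j` too, the clique also contains some (j , l), the head of an arc from (i , j).
    separate : ∀ {i j} → i Fin.< j → ¬ (∀ c → colours i c ≡ colours j c)
    separate {i} {j} i<j same =
      let c , ij∈ = ∈⋃⁻ Cs {combine i j} (subst (combine i j ∈_) (sym union) ∈⊤)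
      in no-common c i<j ij∈ (transfer i j c (same c) (j , i<j , ij∈))
    distinct : ∀ i j → (∀ c → colours i c ≡ colours j c) → i ≡ j
    distinct i j same with Finₚ.<-cmp i j
    ... | tri< i<j _ _ = contradiction same (separate i<j)
    ... | tri≈ _ eq _  = eq
    ... | tri> _ _ j<i = contradiction (λ c → sym (same c)) (separate j<i)

-- Path graphs and grids

Near : ∀ {k} → Fin k → Fin k → Set
Near i j = toℕ j ≡ suc (toℕ i) ⊎ toℕ i ≡ suc (toℕ j)

near? : ∀ {k} (i j : Fin k) → Dec (Near i j)
near? i j = (toℕ j ℕₚ.≟ suc (toℕ i)) ⊎-dec (toℕ i ℕₚ.≟ suc (toℕ j))

near-irrefl : ∀ {k} {i : Fin k} → ¬ Near i i
near-irrefl {i = i} (inj₁ eq) = ℕₚ.1+n≢n {toℕ i} (sym eq)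
near-irrefl {i = i} (inj₂ eq) = ℕₚ.1+n≢n {toℕ i} (sym eq)

near⇒∣-∣≤1 : ∀ {k} {i j : Fin k} → Near i j → ∣ toℕ i - toℕ j ∣ ≤ 1
near⇒∣-∣≤1 {i = i} {j} (inj₁ eq) = subst (λ b → ∣ toℕ i - b ∣ ≤ 1) (sym eq) (gap (toℕ i))
  where
  gap : ∀ a → ∣ a - suc a ∣ ≤ 1
  gap zero    = s≤s z≤n
  gap (suc a) = gap a
near⇒∣-∣≤1 {i = i} {j} (inj₂ eq) =
  subst (_≤ 1) (ℕₚ.∣-∣-comm (toℕ j) (toℕ i)) (near⇒∣-∣≤1 {i = j} {i} (inj₁ eq))

near-constant : ∀ {k} {A : Set} (g : Fin (suc k) → A) →
                (∀ i j → Near i j → g i ≡ g j) → ∀ i → g zero ≡ g i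
near-constant         g g-near zero    = refl
near-constant {suc k} g g-near (suc i) = trans (g-near zero (suc zero) (inj₁ refl))
  (near-constant (g ∘ suc) (λ i j → g-near (suc i) (suc j) ∘ shift) i)
  where
  shift : ∀ {i j} → Near {suc k} i j → Near (suc i) (suc j)
  shift (inj₁ eq) = inj₁ (cong suc eq)
  shift (inj₂ eq) = inj₂ (cong suc eq)

cycle-neighbours : ∀ {n} {G : Graph n} (c : Cycle G) → let open Cycle c in
  ∀ i → ∃[ a ] ∃[ b ] a ≢ b × Adj G (vertex i) (vertex a) × Adj G (vertex i) (vertex b)
cycle-neighbours {G = G} c zero = suc zero , fromℕ _ , (λ ()) , step zero , Adj-sym G close
  where open Cycle c
cycle-neighbours {G = G} c (suc j) with view j
... | ‵fromℕ     = inject₁ j , zero , (λ ()) , Adj-sym G (step j) , close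
  where open Cycle c
... | ‵inject₁ i = inject₁ j , suc (suc i) ,
    (λ eq → ℕₚ.m≢1+n+m (toℕ i) {1} (trans (sym (trans (toℕ-inject₁ j) (toℕ-inject₁ i))) (cong toℕ eq))) ,
    Adj-sym G (step j) , step (suc i)
  where open Cycle c

module _ (k : ℕ) where
  pathGraph : Graph (suc k)
  pathGraph = fromRelation near? swap near-irrefl

  near⇒Adj : ∀ {i j} → Near i j → Adj pathGraph i j
  near⇒Adj {i} {j} = fromWitness {a? = near? i j}

  Adj⇒near : ∀ {i j} → Adj pathGraph i j → Near i j
  Adj⇒near {i} {j} = toWitness {a? = near? i j}

  -- A vertex of largest index on a cycle has only one possible neighbour.
  pathGraph-isTree : IsTree pathGraph
  pathGraph-isTree = record
    { nonEmpty  = _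
    ; connected = λ {s} {t} _ _ → reverse Step-sym (walk _ s refl) ◅◅ walk _ t refl
    ; acyclic   = acyclic
    }
    where
    Step : Fin (suc k) → Fin (suc k) → Set
    Step a b = U a × U b × Adj pathGraph a b
    Step-sym : ∀ {a b} → Step a b → Step b a
    Step-sym (_ , _ , ab) = _ , _ , Adj-sym pathGraph ab
    walk : ∀ d t → toℕ t ≡ d → Star Step zero t
    walk _       zero    _    = ε
    walk (suc d) (suc t) eq = walk d (inject₁ t) (trans (toℕ-inject₁ t) (ℕₚ.suc-injective eq)) ◅◅
      (_ , _ , near⇒Adj {inject₁ t} {suc t} (inj₁ (cong suc (sym (toℕ-inject₁ t))))) ◅ ε
    acyclic : ¬ Cycle pathGraph
    acyclic c with greatestElement (toℕ ∘ vertex) {U} (λ _ → yes tt) (zero , tt)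
      where open Cycle c
    ... | i , _ , max = let a , b , a≢b , ia , ib = cycle-neighbours c i in
        a≢b (distinct (toℕ-injective (ℕₚ.suc-injective (trans (sym (below a ia)) (below b ib)))))
      where
      open Cycle c
      below : ∀ a → Adj pathGraph (vertex i) (vertex a) → toℕ (vertex i) ≡ suc (toℕ (vertex a))
      below a ia with Adj⇒near ia
      ... | inj₁ eq = contradiction (max a tt) (ℕₚ.<⇒≱ (ℕₚ.≤-reflexive (sym eq)))
      ... | inj₂ eq = eq

parity : ℕ → Bool
parity zero    = false
parity (suc n) = not (parity n)

module Grid (k : ℕ) where
  K : ℕ
  K = suc k

  V : Set
  V = Fin (K * K)

  abstract
    x y : V → Fin K
    x = proj₁ ∘ remQuot {K} K
    y = proj₂ ∘ remQuot {K} K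

    point : Fin K → Fin K → V
    point = combine

    x-point : ∀ i j → x (point i j) ≡ i
    x-point i j = cong proj₁ (remQuot-combine i j)

    y-point : ∀ i j → y (point i j) ≡ j
    y-point i j = cong proj₂ (remQuot-combine {K} i j)

    point-xy : ∀ v → point (x v) (y v) ≡ v
    point-xy = combine-remQuot {K} K

  coordinates-injective : ∀ {u v} → x u ≡ x v → y u ≡ y v → u ≡ v
  coordinates-injective {u} {v} ex ey = trans (sym (point-xy u)) (trans (cong₂ point ex ey) (point-xy v))

  GridEdge : V → V → Set
  GridEdge u v = (x u ≡ x v × Near (y u) (y v)) ⊎ (y u ≡ y v × Near (x u) (x v))

  gridEdge? : ∀ u v → Dec (GridEdge u v)
  gridEdge? u v = ((x u ≟ᶠ x v) ×-dec near? (y u) (y v)) ⊎-dec ((y u ≟ᶠ y v) ×-dec near? (x u) (x v))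

  gridEdge-sym : ∀ {u v} → GridEdge u v → GridEdge v u
  gridEdge-sym (inj₁ (eq , near)) = inj₁ (sym eq , swap near)
  gridEdge-sym (inj₂ (eq , near)) = inj₂ (sym eq , swap near)

  gridEdge-irrefl : ∀ {v} → ¬ GridEdge v v
  gridEdge-irrefl (inj₁ (_ , near)) = near-irrefl near
  gridEdge-irrefl (inj₂ (_ , near)) = near-irrefl near

  grid : Graph (K * K)
  grid = fromRelation gridEdge? gridEdge-sym gridEdge-irrefl

  edge⇒Adj : ∀ {u v} → GridEdge u v → Adj grid u v
  edge⇒Adj {u} {v} = fromWitness {a? = gridEdge? u v}

  Adj⇒edge : ∀ {u v} → Adj grid u v → GridEdge u v
  Adj⇒edge {u} {v} = toWitness {a? = gridEdge? u v}

  colour : V → Bool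
  colour v = parity (toℕ (x v) + toℕ (y v))

  colour-proper : ∀ {u v} → GridEdge u v → colour u ≢ colour v
  colour-proper {u} {v} e same = flips (apart e)
    where
    total : V → ℕ
    total v = toℕ (x v) + toℕ (y v)
    apart : ∀ {u v} → GridEdge u v → total v ≡ suc (total u) ⊎ total u ≡ suc (total v)
    apart {u} (inj₁ (eq , inj₁ e)) = inj₁ (trans (cong₂ _+_ (cong toℕ (sym eq)) e) (ℕₚ.+-suc _ _))
    apart {u} (inj₁ (eq , inj₂ e)) = inj₂ (trans (cong₂ _+_ (cong toℕ eq) e) (ℕₚ.+-suc _ _))
    apart {u} (inj₂ (eq , inj₁ e)) = inj₁ (cong₂ _+_ e (cong toℕ (sym eq)))
    apart {u} (inj₂ (eq , inj₂ e)) = inj₂ (cong₂ _+_ e (cong toℕ eq))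
    flips : ¬ (total v ≡ suc (total u) ⊎ total u ≡ suc (total v))
    flips (inj₁ eq) = not-¬ {colour u} refl (trans same (cong parity eq))
    flips (inj₂ eq) = not-¬ {colour v} refl (trans (sym same) (cong parity eq))

  -- The chessboard colouring `colour` splits `S` into two independent sets. This gives both the
  -- linear binding function of grids and the passage from independence numbers of bags to their
  -- sizes.
  card≤2α : ∀ S → ∣ S ∣ ≤ 2 * α grid S
  card≤2α S = begin
    ∣ S ∣                             ≤⟨ ∣p∣≤∣q∣+∣r∣ split ⟩
    ∣ part true ∣ + ∣ part false ∣    ≤⟨ ℕₚ.+-mono-≤ (part≤ true) (part≤ false) ⟩
    α grid S + α grid S               ≡⟨ cong (α grid S +_) (ℕₚ.+-identityʳ _) ⟨
    2 * α grid S                      ∎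
    where
    open ℕₚ.≤-Reasoning
    part? : ∀ b → Decidable (λ v → v ∈ S × colour v ≡ b)
    part? b v = (v ∈? S) ×-dec (colour v ≟ᵇ b)
    part : Bool → Subset (K * K)
    part b = select (part? b)
    split : ∀ {v} → v ∈ S → v ∈ part true ⊎ v ∈ part false
    split {v} v∈ = cases (colour v) refl
      where
      cases : ∀ b → colour v ≡ b → v ∈ part true ⊎ v ∈ part false
      cases true  eq = inj₁ (∈-select⁺ (part? true) (v∈ , eq))
      cases false eq = inj₂ (∈-select⁺ (part? false) (v∈ , eq))
    part≤ : ∀ b → ∣ part b ∣ ≤ α grid S
    part≤ b = α-maximal grid S (proj₁ ∘ ∈-select⁻ (part? b)) λ u v u∈ v∈ uv →
      colour-proper (Adj⇒edge {u} {v} uv)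
        (trans (proj₂ (∈-select⁻ (part? b) u∈)) (sym (proj₂ (∈-select⁻ (part? b) v∈))))

  -- The bags are pairs of consecutive rows, the layers are the columns.
  inRows? : ∀ t v → Dec (toℕ (y v) ≡ toℕ {K} t ⊎ toℕ (y v) ≡ suc (toℕ t))
  inRows? t v = (toℕ (y v) ℕₚ.≟ toℕ t) ⊎-dec (toℕ (y v) ℕₚ.≟ suc (toℕ t))

  rows : Fin K → Subset (K * K)
  rows t = select (inRows? t)

  rowDecomposition : TreeDecomposition grid
  rowDecomposition = record
    { tree     = pathGraph k
    ; isTree   = pathGraph-isTree k
    ; bag      = rows
    ; vertices = λ v → y v , ∈-select⁺ (inRows? (y v)) {v} (inj₁ refl)
    ; edges    = λ u v uv → common {u} {v} (Adj⇒edge {u} {v} uv)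
    ; subtree  = λ v {s} {t} s∈ t∈ → link v s∈ t∈ (∈-select⁻ (inRows? s) s∈) (∈-select⁻ (inRows? t) t∈)
    }
    where
    common : ∀ {u v} → GridEdge u v → ∃[ t ] u ∈ rows t × v ∈ rows t
    common {u} {v} (inj₁ (_ , inj₁ e)) =
      y u , ∈-select⁺ (inRows? (y u)) (inj₁ refl) , ∈-select⁺ (inRows? (y u)) (inj₂ e)
    common {u} {v} (inj₁ (_ , inj₂ e)) =
      y v , ∈-select⁺ (inRows? (y v)) (inj₂ e) , ∈-select⁺ (inRows? (y v)) (inj₁ refl)
    common {u} {v} (inj₂ (e , _)) =
      y u , ∈-select⁺ (inRows? (y u)) (inj₁ refl) , ∈-select⁺ (inRows? (y u)) (inj₁ (cong toℕ (sym e)))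

    -- A vertex of row j lies only in the bags of j and j - 1, so at most one step is needed.
    link : ∀ v {s t} → v ∈ rows s → v ∈ rows t →
           toℕ (y v) ≡ toℕ s ⊎ toℕ (y v) ≡ suc (toℕ s) → toℕ (y v) ≡ toℕ t ⊎ toℕ (y v) ≡ suc (toℕ t) →
           Star (λ a b → v ∈ rows a × v ∈ rows b × Adj (pathGraph k) a b) s t
    link v {s} {t} s∈ t∈ (inj₁ e) (inj₁ e′) = subst (Star _ s) (toℕ-injective (trans (sym e) e′)) ε
    link v {s} {t} s∈ t∈ (inj₂ e) (inj₂ e′) =
      subst (Star _ s) (toℕ-injective (ℕₚ.suc-injective (trans (sym e) e′))) ε
    link v {s} {t} s∈ t∈ (inj₁ e) (inj₂ e′) = (s∈ , t∈ , near⇒Adj k {s} {t} (inj₂ (trans (sym e) e′))) ◅ ε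
    link v {s} {t} s∈ t∈ (inj₂ e) (inj₁ e′) = (s∈ , t∈ , near⇒Adj k {s} {t} (inj₁ (trans (sym e′) e))) ◅ ε

  columns : Layering grid
  columns = record { index = toℕ ∘ x ; adjacent = λ u v uv → close (Adj⇒edge {u} {v} uv) }
    where
    close : ∀ {u v} → GridEdge u v → ∣ toℕ (x u) - toℕ (x v) ∣ ≤ 1
    close {u} {v} (inj₁ (e , _)) =
      subst (λ i → ∣ toℕ (x u) - toℕ i ∣ ≤ 1) e (subst (_≤ 1) (sym (ℕₚ.∣n-n∣≡0 (toℕ (x u)))) z≤n)
    close (inj₂ (_ , near)) = near⇒∣-∣≤1 near

  grid-layeredTreewidth≤2 : LayeredTreewidth≤ 2 grid
  grid-layeredTreewidth≤2 = rowDecomposition , columns , narrow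
    where
    narrow : ∀ t i → ∣ rows t ∩ layer columns i ∣ ≤ 2
    narrow t i = ℕₚ.≤-trans (∣p∣≤∣q∣+∣r∣ {q = part (toℕ t)} {part (suc (toℕ t))} split)
      (ℕₚ.+-mono-≤ (part≤1 (toℕ t)) (part≤1 (suc (toℕ t))))
      where
      part? : ∀ j → Decidable (λ v → toℕ (x v) ≡ i × toℕ (y v) ≡ j)
      part? j v = (toℕ (x v) ℕₚ.≟ i) ×-dec (toℕ (y v) ℕₚ.≟ j)
      part : ℕ → Subset (K * K)
      part j = select (part? j)
      part≤1 : ∀ j → ∣ part j ∣ ≤ 1
      part≤1 j = ∣p∣≤1 (part j) λ u∈ v∈ →
        let ux , uy = ∈-select⁻ (part? j) u∈
            vx , vy = ∈-select⁻ (part? j) v∈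
        in coordinates-injective (toℕ-injective (trans ux (sym vx))) (toℕ-injective (trans uy (sym vy)))
      split : ∀ {v} → v ∈ rows t ∩ layer columns i → v ∈ part (toℕ t) ⊎ v ∈ part (suc (toℕ t))
      split {v} v∈ with x∈p∩q⁻ (rows t) (layer columns i) v∈
      ... | v∈rows , v∈layer with ∈-select⁻ (inRows? t) v∈rows | ∈-select⁻ (λ v → toℕ (x v) ℕₚ.≟ i) v∈layer
      ...   | inj₁ e | e′ = inj₁ (∈-select⁺ (part? (toℕ t)) (e′ , e))
      ...   | inj₂ e | e′ = inj₂ (∈-select⁺ (part? (suc (toℕ t))) (e′ , e))

  row? : ∀ j → Decidable (λ v → y v ≡ j)
  row? j v = y v ≟ᶠ j

  row-size : ∀ j → ∣ select (row? j) ∣ ≤ K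
  row-size j = subst (∣ select (row? j) ∣ ≤_) (trans (cong (_* 1) (∣⊤∣≡n K)) (ℕₚ.*-identityʳ K))
    (cover-bound (select (row? j)) (⊤ {K}) (λ i → select (cell? i))
      (λ {v} v∈ → x v , ∈⊤ , ∈-select⁺ (cell? (x v)) (refl , ∈-select⁻ (row? j) v∈))
      (λ i → ∣p∣≤1 (select (cell? i)) λ u∈ v∈ →
        let ux , uy = ∈-select⁻ (cell? i) u∈
            vx , vy = ∈-select⁻ (cell? i) v∈
        in coordinates-injective (trans ux (sym vx)) (trans uy (sym vy))))
    where
    cell? : ∀ i → Decidable (λ v → x v ≡ i × y v ≡ j)
    cell? i v = (x v ≟ᶠ i) ×-dec (y v ≟ᶠ j)

  -- All rows that avoid X lie in one component of grid - X, since some column avoids X as well.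
  balanced-separator-size : ∀ {X} (𝒫 : Pieces grid X) → Pieces.AtMostHalf 𝒫 → ∣ X ∣ < K → K ≤ 2 * ∣ X ∣
  balanced-separator-size {X} 𝒫 half X<K = ℕₚ.*-cancelʳ-≤ K (2 * ∣ X ∣) K (begin
    K * K              ≤⟨ large-complement 𝒫 half Z (label (point x₀ zero)) rest ⟩
    2 * ∣ Z ∣          ≤⟨ ℕₚ.*-monoʳ-≤ 2 Z-size ⟩
    2 * (∣ X ∣ * K)    ≡⟨ ℕₚ.*-assoc 2 ∣ X ∣ K ⟨
    2 * ∣ X ∣ * K      ∎)
    where
    open ℕₚ.≤-Reasoning
    open Pieces 𝒫
    -- The rows that meet `X`: at most ∣ X ∣ rows with `K` vertices each. As they make up at least
    -- half of the K * K vertices, K ≤ 2 ∣ X ∣ follows.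
    Z? : Decidable (λ v → ∃[ u ] u ∈ X × y v ≡ y u)
    Z? v = any? λ u → (u ∈? X) ×-dec row? (y u) v
    Z : Subset (K * K)
    Z = select Z?
    Z-size : ∣ Z ∣ ≤ ∣ X ∣ * K
    Z-size = cover-bound Z X (λ u → select (row? (y u)))
      (λ {v} v∈ → let u , u∈ , eq = ∈-select⁻ Z? v∈ in u , u∈ , ∈-select⁺ (row? (y u)) eq)
      (λ u → row-size (y u))

    hit? : ∀ i → Dec (∃[ v ] v ∈ X × x v ≡ i)
    hit? i = any? λ v → (v ∈? X) ×-dec (x v ≟ᶠ i)
    intactColumn : ∃[ i ] ¬ (∃[ v ] v ∈ X × x v ≡ i)
    intactColumn = ¬∀⟶∃¬ K (λ i → ∃[ v ] v ∈ X × x v ≡ i) hit? λ all-hit → ℕₚ.<⇒≱ X<K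
      (subst₂ _≤_ (∣⊤∣≡n K) (ℕₚ.*-identityʳ ∣ X ∣)
        (cover-bound (⊤ {K}) X (λ v → ⁅ x v ⁆)
          (λ {i} _ → let v , v∈ , eq = all-hit i in v , v∈ , subst (_∈ ⁅ x v ⁆) eq (x∈⁅x⁆ (x v)))
          (λ v → ℕₚ.≤-reflexive (∣⁅x⁆∣≡1 (x v)))))
    x₀ : Fin K
    x₀ = proj₁ intactColumn

    column-avoids : ∀ j → point x₀ j ∉ X
    column-avoids j v∈ = proj₂ intactColumn (point x₀ j , v∈ , x-point x₀ j)

    column-constant : ∀ j → label (point x₀ zero) ≡ label (point x₀ j)
    column-constant = near-constant (label ∘ point x₀) λ i j near →
      constant (column-avoids i) (column-avoids j) (edge⇒Adj {point x₀ i} {point x₀ j} (inj₁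
        (trans (x-point x₀ i) (sym (x-point x₀ j)) ,
         subst₂ Near (sym (y-point x₀ i)) (sym (y-point x₀ j)) near)))

    row-constant : ∀ {v} → v ∉ Z → ∀ i → label (point zero (y v)) ≡ label (point i (y v))
    row-constant {v} v∉ = near-constant (λ i → label (point i (y v))) λ i j near →
      constant (avoids i) (avoids j) (edge⇒Adj {point i (y v)} {point j (y v)} (inj₂
        (trans (y-point i (y v)) (sym (y-point j (y v))) ,
         subst₂ Near (sym (x-point i (y v))) (sym (x-point j (y v))) near)))
      where
      avoids : ∀ i → point i (y v) ∉ X
      avoids i u∈ = v∉ (∈-select⁺ Z? (point i (y v) , u∈ , sym (y-point i (y v))))

    rest : ∀ {v} → v ∉ Z → v ∈ piece (label (point x₀ zero))
    rest {v} v∉ = ∈-select⁺ (inPiece? (label (point x₀ zero)))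
      ((λ v∈ → v∉ (∈-select⁺ Z? (v , v∈ , refl))) , (begin-equality
      label v                      ≡⟨ cong label (point-xy v) ⟨
      label (point (x v) (y v))    ≡⟨ row-constant v∉ (x v) ⟨
      label (point zero (y v))     ≡⟨ row-constant v∉ x₀ ⟩
      label (point x₀ (y v))       ≡⟨ column-constant (y v) ⟨
      label (point x₀ zero)        ∎))

  -- The 4 is a factor 2 from the balanced bag times a factor 2 from bipartiteness.
  grid-treeIndependenceNumber : ∀ {ℓ} → TreeIndependenceNumber≤ ℓ grid → K ≤ 4 * ℓ
  grid-treeIndependenceNumber {ℓ} (D , α≤ℓ) = conclude (balancedBag D)
    where
    open ℕₚ.≤-Reasoning
    conclude : Σ (Node D) (λ t → Σ (Pieces grid (bag D t)) Pieces.AtMostHalf) → K ≤ 4 * ℓ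
    conclude (t , 𝒫 , half) = cases (ℕₚ.<-≤-connex ∣ bag D t ∣ K)
      where
      size : ∣ bag D t ∣ ≤ 2 * ℓ
      size = ℕₚ.≤-trans (card≤2α (bag D t)) (ℕₚ.*-monoʳ-≤ 2 (α≤ℓ t))
      cases : ∣ bag D t ∣ < K ⊎ K ≤ ∣ bag D t ∣ → K ≤ 4 * ℓ
      cases (inj₁ small) = begin
        K                  ≤⟨ balanced-separator-size 𝒫 half small ⟩
        2 * ∣ bag D t ∣    ≤⟨ ℕₚ.*-monoʳ-≤ 2 size ⟩
        2 * (2 * ℓ)        ≡⟨ ℕₚ.*-assoc 2 2 ℓ ⟨
        4 * ℓ              ∎
      cases (inj₂ large) = begin
        K              ≤⟨ large ⟩
        ∣ bag D t ∣    ≤⟨ size ⟩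
        2 * ℓ          ≤⟨ ℕₚ.*-monoˡ-≤ ℓ (ℕₚ.m≤m+n 2 2) ⟩
        4 * ℓ          ∎

-- Incomparability

layeredTreewidth⇒layeredTreeIndependence :
  BoundedLayeredTreewidth Implies BoundedLayeredTreeIndependenceNumber
layeredTreewidth⇒layeredTreeIndependence 𝒢 (ℓ , decomposition) = ℓ , λ G G∈ →
  let D , L , narrow = decomposition G G∈ in
  D , L , λ t i → ℕₚ.≤-trans (α≤card G (bag D t ∩ layer L i)) (narrow t i)

treeIndependence⇒layeredTreeIndependence :
  BoundedTreeIndependenceNumber Implies BoundedLayeredTreeIndependenceNumber
treeIndependence⇒layeredTreeIndependence 𝒢 (ℓ , decomposition) = ℓ , λ G G∈ →
  let D , α≤ℓ = decomposition G G∈ in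
  D , oneLayer G , λ t i → α≤ G (bag D t ∩ layer (oneLayer G) i) λ I⊆ →
    α-bounded G (bag D t) (α≤ℓ t) (p∩q⊆p (bag D t) (layer (oneLayer G) i) ∘ I⊆)

withSublinear : ∀ {P : Property} → P Implies BoundedLayeredTreeIndependenceNumber →
                P Implies (BoundedLayeredTreeIndependenceNumber And SublinearCliqueBasedSeparators)
withSublinear layered 𝒢 p = layered 𝒢 p , boundedLayered⇒sublinear 𝒢 (layered 𝒢 p)

data Complete : GraphClass where
  complete∈ : ∀ m → Complete (complete (suc m))

data CoShift : GraphClass where
  coShift∈ : ∀ N → CoShift (coShift N)

data Grids : GraphClass where
  grid∈ : ∀ k → Grids (Grid.grid k)

complete-tree : BoundedTreeIndependenceNumber Complete
complete-tree = 1 , λ { _ (complete∈ m) → singleBag (complete (suc m)) , λ _ → complete-α≤1 (suc m) ⊤ }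

complete-θ : SubquadraticθBindingFunction Complete
complete-θ = (λ _ → fromNatᵣ 1) ,
  (λ { _ (complete∈ m) S → ≼⇒≤ᵣ {fromNatᵣ _} {1}
    (≼-trans {fromNatᵣ _} (λ _ → ℚₚ.≤-refl) (complete-θ≤1 (suc m) S)) }) ,
  fromNatᵣ-∈o (λ _ → 1) (_^ 2) (λ d → suc d , λ x d<x → begin
    suc d * 1     ≤⟨ ℕₚ.*-mono-≤ d<x (ℕₚ.≤-trans (s≤s z≤n) d<x) ⟩
    x * x         ≡⟨ cong (x *_) (ℕₚ.*-identityʳ x) ⟨
    x ^ 2         ∎)
  where
  open ℕₚ.≤-Reasoning

¬complete-layeredTreewidth : ¬ BoundedLayeredTreewidth Complete
¬complete-layeredTreewidth (ℓ , narrow) =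
  ℕₚ.<-irrefl refl (complete-layeredTreewidth (narrow _ (complete∈ (2 * (3 * ℓ)))))

coShift-tree : BoundedTreeIndependenceNumber CoShift
coShift-tree = 2 , λ { _ (coShift∈ N) → singleBag (coShift N) , λ _ → coShift-α≤2 N ⊤ }

-- Only the values 0, 1 and 2 of α occur, so a binding function caps θ by some constant `B`; but k
-- cliques cover at most the case N ≤ 2 ^ k, which fails for N = 2 ^ B + 1.
¬coShift-θ : ¬ SubquadraticθBindingFunction CoShift
¬coShift-θ (f , binding , _) = conclude (bound-below f 2)
  where
  conclude : (∃[ B ] ∀ m x → x ≤ 2 → fromNatᵣ m ≤ᵣ f x → m ≤ B) → Absurd
  conclude (B , below) = ℕₚ.<⇒≱ (ℕₚ.n<1+n (2 ^ B))
    (ℕₚ.≤-trans (coShift-cover N (θ-attained (coShift N) ⊤)) (ℕₚ.^-monoʳ-≤ 2 θ≤B))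
    where
    N : ℕ
    N = suc (2 ^ B)
    θ≤B : θ (coShift N) ⊤ ≤ B
    θ≤B = below (θ (coShift N) ⊤) (α (coShift N) ⊤) (coShift-α≤2 N ⊤) (binding (coShift N) (coShift∈ N) ⊤)

grids-layeredTreewidth : BoundedLayeredTreewidth Grids
grids-layeredTreewidth = 2 , λ { _ (grid∈ k) → Grid.grid-layeredTreewidth≤2 k }

grids-θ : SubquadraticθBindingFunction Grids
grids-θ = (λ x → fromNatᵣ (2 * x)) ,
  (λ { _ (grid∈ k) S → ≼⇒≤ᵣ {fromNatᵣ _} {2 * α (Grid.grid k) S} (≼-trans {fromNatᵣ _} (λ _ → ℚₚ.≤-refl)
    (ℕₚ.≤-trans (θ≤card (Grid.grid k) S) (Grid.card≤2α k S))) }) ,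
  fromNatᵣ-∈o (2 *_) (_^ 2) (λ d → suc d * 2 , λ x d<x → begin
    suc d * (2 * x) ≡⟨ ℕₚ.*-assoc (suc d) 2 x ⟨
    suc d * 2 * x   ≤⟨ ℕₚ.*-monoˡ-≤ x d<x ⟩
    x * x           ≡⟨ cong (x *_) (ℕₚ.*-identityʳ x) ⟨
    x ^ 2           ∎)
  where
  open ℕₚ.≤-Reasoning

¬grids-tree : ¬ BoundedTreeIndependenceNumber Grids
¬grids-tree (ℓ , small) =
  ℕₚ.<-irrefl refl (Grid.grid-treeIndependenceNumber (4 * ℓ) (small _ (grid∈ (4 * ℓ))))

proposition5p4 :
  let a = BoundedLayeredTreeIndependenceNumber And SubquadraticθBindingFunction
      b = BoundedLayeredTreewidth
      c = BoundedTreeIndependenceNumber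
      conclusion = BoundedLayeredTreeIndependenceNumber And SublinearCliqueBasedSeparators
  in (a Implies conclusion)
     × (b Implies conclusion)
     × (c Implies conclusion)
     × (a IncomparableTo c)
     × (b IncomparableTo c)
     × (¬ (a Implies b))
proposition5p4 =
    withSublinear (λ _ → proj₁)
  , withSublinear layeredTreewidth⇒layeredTreeIndependence
  , withSublinear treeIndependence⇒layeredTreeIndependence
  , ( (λ a⇒c → ¬grids-tree (a⇒c Grids
        (layeredTreewidth⇒layeredTreeIndependence Grids grids-layeredTreewidth , grids-θ)))
    , (λ c⇒a → ¬coShift-θ (proj₂ (c⇒a CoShift coShift-tree))))
  , ( (λ b⇒c → ¬grids-tree (b⇒c Grids grids-layeredTreewidth))
    , (λ c⇒b → ¬complete-layeredTreewidth (c⇒b Complete complete-tree)))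
  -- Only this direction can be refuted, since `b` does imply `a`: in every nonempty induced
  -- subgraph of a graph of layered treewidth at most ℓ some vertex has fewer than 3 ℓ neighbours,
  -- as a bag has at most 3 ℓ vertices in three consecutive layers, and so θ ≤ 3 ℓ α.
  , (λ a⇒b → ¬complete-layeredTreewidth
      (a⇒b Complete (treeIndependence⇒layeredTreeIndependence Complete complete-tree , complete-θ)))
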